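{- Let $n,m\ge1$, $\mathbf{x}=(x_1,\ldots,x_n)$, $\mathbf{z}=(z_1,\ldots,z_m)$. For a partition $\lambda$ let $$g_\lambda(\mathbf{x};\mathbf{z})=\sum_{\mathrm{sh}(\pi)=\lambda}\ \prod_{(i,j)\in\mathrm{Des}(\pi)}x_i z_{\pi_{ij}},$$ where the sum runs over plane partitions $\pi\in\mathrm{PP}(\infty,n,m)$ of shape $\lambda$. These polynomials satisfy the following properties. (i) For $\ell(\lambda)\le n$, $g_\lambda(\mathbf{x};\mathbf{z})=\mathbf{x}^\lambda s_\lambda(\mathbf{z})+\text{(terms of lower degree)}$, where $\mathbf{x}^\lambda=x_1^{\lambda_1}\cdots x_n^{\lambda_n}$ and $s_\lambda$ is the Schur polynomial. Moreover, each monomial $\mathbf{x}^\alpha\mathbf{z}^\beta$ occurring in $g_\lambda(\mathbf{x};\mathbf{z})$ has $|\alpha|=|\beta|$. (ii) $$g_\lambda(\mathbf{x};\mathbf{z})=\sum_{\mathrm{sh}(\pi)=\lambda}\ \prod_{i=1}^{n}x_i^{d_i(\pi)}\prod_{j=1}^{m}z_j^{c_j(\pi)},$$ where the sum runs over plane partitions $\pi\in\mathrm{PP}(\infty,n,m)$ of shape $\lambda$, $c_j(\pi)$ is the number of columns of $\pi$ containing $j$, and $d_i(\pi)$ is the number of entries in the $i$th row of $\pi$ that are strictly larger than the entry below. (iii) For $\ell(\lambda)\le n$, $g_\lambda(1^n;\mathbf{z})=g_\lambda(\mathbf{z})$, the dual symmetric Grothendieck polynomial, where $1^n=(1,\ldots,1)$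 ($n$ times). (iv) The following Cauchy-type identity holds (as formal power series): $$\sum_{\ell(\lambda)\le n}g_\lambda(\mathbf{x};\mathbf{z})=\prod_{i=1}^{n}\prod_{j=1}^{m}\frac{1}{1-x_i z_j},$$ where the sum is over all partitions $\lambda$ with at most $n$ parts.
   Context: A plane partition $\pi=(\pi_{ij})_{i,j\ge1}$ is a two-dimensional array of nonnegative integers with finitely many nonzero entries such that $\pi_{ij}\ge\pi_{i+1\,j}$ and $\pi_{ij}\ge\pi_{i\,j+1}$ for all $i,j$ ($i$ is the row index, $j$ the column index). Zero entries are ignored (not regarded as entries of $\pi$). Its shape $\mathrm{sh}(\pi)$ is the partition whose Young diagram is $\{(i,j):\pi_{ij}>0\}$. $\mathrm{PP}(\infty,n,m)$ is the set of plane partitions with at most $n$ nonzero rows and all entries at most $m$ (the number of columns is not restricted). $\mathrm{Des}(\pi)=\{(i,j):\pi_{ij}>\pi_{i+1\,j}\}$. $\ell(\lambda)$ is the number of (positive) parts of $\lambda$, with $\lambda_i=0$ for $i>\ell(\lambda)$. The Schur polynomial is $s_\lambda(z_1,\ldots,z_m)=\sum_\pi\prod_{i=1}^m z_i^{a_i(\pi)}$, the sum over column-strict plane partitions $\pi$ of shape $\lambda$ (that is, $\pi_{ij}>\pi_{i+1\,j}$ for every cell $(i,j)$ of $\lambda$) with largest entry at most $m$, where $a_i(\pi)$ is the number of entries $i$ in $\pi$. The dual symmetric Grothendieck polynomial is $g_\lambda(z_1,\ldots,z_m)=\sum_{\mathrm{sh}(\pi)=\lambda}\prod_{i=1}^m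 z_i^{c_i(\pi)}$, the sum over plane partitions $\pi$ of shape $\lambda$ with largest entry at most $m$, where $c_i(\pi)$ is the number of columns of $\pi$ containing $i$. -}

module Defs where

open import Algebra.Bundles.Raw using (RawRing; RawMonoid)
import Algebra.Definitions.RawSemiring as RawSemiringDefinitions
open import Data.Bool.Base using (if_then_else_)
open import Data.Empty using (⊥-elim)
open import Data.Fin.Base using (Fin; toℕ; fromℕ<)
open import Data.Integer.Base as ℤ using (ℤ; 0ℤ; 1ℤ)
import Data.Integer.Properties as ℤ
open import Data.List.Base using (List; []; _∷_; length; map; foldr; filter; concat; concatMap; upTo; applyUpTo; cartesianProductWith; _++_)
open import Data.List.Properties using (∷-injective; ≡-dec; length-++; map-upTo; map-applyUpTo)
open import Data.List.Membership.Propositional using (_∈_)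
open import Data.List.Membership.Propositional.Properties
open import Data.List.Relation.Unary.All as All using (All; []; _∷_)
open import Data.List.Relation.Unary.Any using (here; there)
open import Data.List.Relation.Unary.Linked using (Linked)
open import Data.List.Relation.Unary.Unique.Propositional using (Unique; []; _∷_)
import Data.List.Relation.Unary.Unique.Propositional.Properties as Unique
open import Data.Nat.Base using (ℕ; zero; suc; pred; _≤_; _<_; _≥_; z≤n; s≤s)
open import Data.Nat.Base as ℕ using (_∸_)
open import Data.Nat.ListAction using (sum)
open import Data.Nat.Properties as ℕ using (_≤?_; _<?_; _≟_; allUpTo?)
open import Data.List.Membership.DecPropositional _≟_ using (_∈?_)
open import Data.Product.Base using (Σ; Σ-syntax; _×_; _,_; proj₁; proj₂)
open import Data.Sum.Base using (_⊎_; inj₁; inj₂)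
open import Data.Vec.Base as Vec using (Vec; []; _∷_; replicate; _[_]≔_)
import Data.Vec.Properties as Vec
open import Function.Base using (_∘_)
open import Level using (0ℓ)
open import Relation.Binary.PropositionalEquality
open import Relation.Nullary using (Dec; yes; no; does; ¬_; contradiction)
open import Relation.Nullary.Decidable using (_×-dec_; _→-dec_; map′)
open import Relation.Unary using (Decidable)

------------------------------------------------------------------------
-- Partitions

-- Proofs are irrelevant, so two partitions with the same parts are
-- propositionally equal.
record Partition : Set where
  constructor partition
  field
    parts       : List ℕ
    .positive   : All (0 <_) parts
    .decreasing : Linked _≥_ parts

open Partition public using (parts)

ℓ : Partition → ℕ
ℓ p = length (parts p)

∣_∣ₚ : Partition → ℕ
∣ p ∣ₚ = sum (parts p)

-- Indices start at 0; missing entries are 0.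
_‼_ : List ℕ → ℕ → ℕ
[]       ‼ _     = 0
(a ∷ _)  ‼ zero  = a
(_ ∷ as) ‼ suc i = as ‼ i

part : Partition → ℕ → ℕ
part p i = parts p ‼ i

------------------------------------------------------------------------
-- Plane partitions

-- An array with finitely many nonzero entries, given by its nonzero rows
-- with trailing zeros removed.  Row and column indices start at 0, so the
-- entry written π_{ij} on paper is  entry π (i - 1) (j - 1).
Array : Set
Array = List (List ℕ)

row : Array → ℕ → List ℕ
row []       _       = []
row (r ∷ _)  zero    = r
row (_ ∷ rs) (suc i) = row rs i

entry : Array → ℕ → ℕ → ℕ
entry π i j = row π i ‼ j

shape : Array → List ℕ
shape = map length

-- The first two fields say that only nonzero entries and rows are listed,
-- so that each plane partition has exactly one representation and its
-- Young diagram is read off from the row lengths.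
record IsPlanePartition (π : Array) : Set where
  constructor isPlanePartition
  field
    entries-positive : All (All (0 <_)) π
    rows-nonempty    : All (λ r → 0 < length r) π
    down             : ∀ i j → entry π (suc i) j ≤ entry π i j
    right            : ∀ i j → entry π i (suc j) ≤ entry π i j

EntriesAtMost : ℕ → Array → Set
EntriesAtMost m π = ∀ i j → entry π i j ≤ m

-- PP n m is the set PP(∞,n,m).
PP : ℕ → ℕ → Array → Set
PP n m π = IsPlanePartition π × length π ≤ n × EntriesAtMost m π

ColumnStrict : Array → Set
ColumnStrict π = ∀ i j → j < shape π ‼ i → entry π (suc i) j < entry π i j

_HasShape_ : Array → Partition → Set
π HasShape p = shape π ≡ parts p

cells : Array → List (ℕ × ℕ)
cells π = concatMap (λ i → map (i ,_) (upTo (length (row π i)))) (upTo (length π))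

-- Descents are necessarily nonzero entries, so only cells of the shape
-- need to be inspected.
Des : Array → List (ℕ × ℕ)
Des π = filter (λ (i , j) → entry π (suc i) j <? entry π i j) (cells π)

-- The j-th column, possibly with zeros at the end.
column : Array → ℕ → List ℕ
column π j = map (λ i → entry π i j) (upTo (length π))

-- a π v, c π v: number of entries equal to v, of columns containing v
-- (only used for v ≥ 1).
a : Array → ℕ → ℕ
a π v = length (filter (_≟ v) (concat π))

-- The first row of a plane partition is its longest.
c : Array → ℕ → ℕ
c π v = length (filter (λ j → v ∈? column π j) (upTo (length (row π 0))))

d : Array → ℕ → ℕ
d π i = length (filter (λ j → entry π (suc i) j <? entry π i j) (upTo (length (row π i))))

------------------------------------------------------------------------
-- Finite sets, listed without repetition

record Enumeration {A : Set} (P : A → Set) : Set where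
  field
    elements : List A
    unique   : Unique elements
    sound    : ∀ {x} → x ∈ elements → P x
    complete : ∀ {x} → P x → x ∈ elements

open Enumeration public using (elements)

‼-≥ : ∀ xs {j} → length xs ≤ j → xs ‼ j ≡ 0
‼-≥ []       _         = refl
‼-≥ (x ∷ xs) (s≤s len) = ‼-≥ xs len

‼-map-length : ∀ π i → shape π ‼ i ≡ length (row π i)
‼-map-length []      _       = refl
‼-map-length (_ ∷ _) zero    = refl
‼-map-length (_ ∷ π) (suc i) = ‼-map-length π i

row-≥ : ∀ π {i} → length π ≤ i → row π i ≡ []
row-≥ []      _         = refl
row-≥ (_ ∷ π) (s≤s len) = row-≥ π len

row-length-≤ : ∀ π i → length (row π i) ≤ length (concat π)
row-length-≤ []      _       = z≤n
row-length-≤ (r ∷ π) zero    = ℕ.≤-trans (ℕ.m≤m+n _ _) (ℕ.≤-reflexive (sym (length-++ r)))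
row-length-≤ (r ∷ π) (suc i) = ℕ.≤-trans (row-length-≤ π i)
  (ℕ.≤-trans (ℕ.m≤n+m _ (length r)) (ℕ.≤-reflexive (sym (length-++ r))))

Outside : Array → ℕ → ℕ → Set
Outside π i j = length π ≤ i ⊎ length (concat π) ≤ j

entry-outside : ∀ π {i j} → Outside π i j → entry π i j ≡ 0
entry-outside π {j = j} (inj₁ len) = cong (_‼ j) (row-≥ π len)
entry-outside π {i}     (inj₂ len) = ‼-≥ (row π i) (ℕ.≤-trans (row-length-≤ π i) len)

everywhere? : ∀ π {P : ℕ → ℕ → Set} → (∀ i j → Dec (P i j)) →
              (∀ i j → Outside π i j → P i j) → Dec (∀ i j → P i j)
everywhere? π {P} P? out = map′ to (λ f _ _ → f _ _)
  (allUpTo? (λ i → allUpTo? (P? i) (length (concat π))) (length π))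
  where
  to : (∀ {i} → i < length π → ∀ {j} → j < length (concat π) → P i j) → ∀ i j → P i j
  to f i j with i <? length π | j <? length (concat π)
  ... | yes i< | yes j< = f i< j<
  ... | no  i≮ | _      = out i j (inj₁ (ℕ.≮⇒≥ i≮))
  ... | yes _  | no  j≮ = out i j (inj₂ (ℕ.≮⇒≥ j≮))

isPlanePartition? : Decidable IsPlanePartition
isPlanePartition? π = map′
  (λ (p , q , r , s) → isPlanePartition p q r s)
  (λ (isPlanePartition p q r s) → p , q , r , s)
  (All.all? (All.all? (0 <?_)) π ×-dec All.all? (λ r → 0 <? length r) π
   ×-dec everywhere? π (λ i j → entry π (suc i) j ≤? entry π i j)
           (λ i j out → subst (_≤ entry π i j) (sym (entry-outside π {suc i} {j} (below out))) z≤n)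
   ×-dec everywhere? π (λ i j → entry π i (suc j) ≤? entry π i j)
           (λ i j out → subst (_≤ entry π i j) (sym (entry-outside π {i} {suc j} (beside out))) z≤n))
  where
  below : ∀ {i j} → Outside π i j → Outside π (suc i) j
  below (inj₁ l) = inj₁ (ℕ.m≤n⇒m≤1+n l)
  below (inj₂ l) = inj₂ l
  beside : ∀ {i j} → Outside π i j → Outside π i (suc j)
  beside (inj₁ l) = inj₁ l
  beside (inj₂ l) = inj₂ (ℕ.m≤n⇒m≤1+n l)

entriesAtMost? : ∀ m → Decidable (EntriesAtMost m)
entriesAtMost? m π = everywhere? π (λ i j → entry π i j ≤? m)
  (λ i j out → subst (_≤ m) (sym (entry-outside π out)) z≤n)

columnStrict? : Decidable ColumnStrict
columnStrict? π = everywhere? π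
  (λ i j → (j <? shape π ‼ i) →-dec (entry π (suc i) j <? entry π i j))
  λ i j out j< → contradiction (subst (j <_) (‼-map-length π i) j<) (no-cell i j out)
  where
  no-cell : ∀ i j → Outside π i j → ¬ j < length (row π i)
  no-cell i j (inj₁ l) j< with () ← subst (λ r → j < length r) (row-≥ π l) j<
  no-cell i j (inj₂ l) j< = ℕ.<⇒≱ j< (ℕ.≤-trans (row-length-≤ π i) l)

hasShape? : ∀ p → Decidable (_HasShape p)
hasShape? p π = ≡-dec _≟_ (shape π) (parts p)

words : ℕ → ℕ → List (List ℕ)
words m zero    = [] ∷ []
words m (suc k) = cartesianProductWith _∷_ (map suc (upTo m)) (words m k)

fillings : ℕ → List ℕ → List Array
fillings m []       = [] ∷ []
fillings m (k ∷ ks) = cartesianProductWith _∷_ (words m k) (fillings m ks)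

words-unique : ∀ m k → Unique (words m k)
words-unique m zero    = [] ∷ []
words-unique m (suc k) = Unique.cartesianProductWith⁺ _∷_ ∷-injective
  (Unique.map⁺ ℕ.suc-injective (Unique.upTo⁺ m)) (words-unique m k)

fillings-unique : ∀ m ks → Unique (fillings m ks)
fillings-unique m []       = [] ∷ []
fillings-unique m (k ∷ ks) = Unique.cartesianProductWith⁺ _∷_ ∷-injective
  (words-unique m k) (fillings-unique m ks)

words-complete : ∀ m r → All (0 <_) r → (∀ j → r ‼ j ≤ m) → r ∈ words m (length r)
words-complete m []          []       _  = here refl
words-complete m (suc v ∷ r) (_ ∷ ps) ≤m = ∈-cartesianProductWith⁺ _∷_
  (∈-map⁺ suc (∈-upTo⁺ (≤m 0))) (words-complete m r ps (≤m ∘ suc))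

fillings-complete : ∀ m π → All (All (0 <_)) π → EntriesAtMost m π → π ∈ fillings m (shape π)
fillings-complete m []      []       _  = here refl
fillings-complete m (r ∷ π) (p ∷ ps) ≤m = ∈-cartesianProductWith⁺ _∷_
  (words-complete m r p (≤m 0)) (fillings-complete m π ps (≤m ∘ suc))

enumerate : ∀ m p {P : Array → Set} → Decidable P →
            (∀ {π} → P π → IsPlanePartition π × EntriesAtMost m π × π HasShape p) →
            Enumeration P
enumerate m p P? bound = record
  { elements = filter P? (fillings m (parts p))
  ; unique   = Unique.filter⁺ P? (fillings-unique m (parts p))
  ; sound    = λ π∈ → proj₂ (∈-filter⁻ P? {xs = fillings m (parts p)} π∈)
  ; complete = λ {π} Pπ → let (pp , ≤m , sh) = bound Pπ in
      ∈-filter⁺ P? (subst (λ μ → π ∈ fillings m μ) sh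
        (fillings-complete m π (IsPlanePartition.entries-positive pp) ≤m)) Pπ
  }

PP-ofShape : ∀ n m p → Enumeration (λ π → PP n m π × π HasShape p)
PP-ofShape n m p = enumerate m p
  (λ π → (isPlanePartition? π ×-dec (length π ≤? n) ×-dec entriesAtMost? m π) ×-dec hasShape? p π)
  (λ ((pp , _ , ≤m) , sh) → pp , ≤m , sh)

planePartitions : ∀ m p →
  Enumeration (λ π → IsPlanePartition π × EntriesAtMost m π × π HasShape p)
planePartitions m p = enumerate m p
  (λ π → isPlanePartition? π ×-dec entriesAtMost? m π ×-dec hasShape? p π) (λ q → q)

columnStrictPlanePartitions : ∀ m p →
  Enumeration (λ π → IsPlanePartition π × ColumnStrict π × EntriesAtMost m π × π HasShape p)
columnStrictPlanePartitions m p = enumerate m p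
  (λ π → isPlanePartition? π ×-dec columnStrict? π ×-dec entriesAtMost? m π ×-dec hasShape? p π)
  (λ (pp , _ , ≤m , sh) → pp , ≤m , sh)

------------------------------------------------------------------------
-- Formal power series over ℤ in k variables

bigOp : (M : RawMonoid 0ℓ 0ℓ) {A : Set} →
        List A → (A → RawMonoid.Carrier M) → RawMonoid.Carrier M
bigOp M xs f = foldr (RawMonoid._∙_ M) (RawMonoid.ε M) (map f xs)

-- An exponent vector.
Monomial : ℕ → Set
Monomial = Vec ℕ

degree : ∀ {k} → Monomial k → ℕ
degree = Vec.sum

-- A series is the family of its coefficients.  Polynomials are regarded
-- as series.
Series : ℕ → Set
Series k = Monomial k → ℤ

∑ℤ : {A : Set} → List A → (A → ℤ) → ℤ
∑ℤ = bigOp ℤ.+-0-rawMonoid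

monomial : ∀ {k} → Monomial k → Series k
monomial e e′ = if does (Vec.≡-dec _≟_ e e′) then 1ℤ else 0ℤ

-- All pairs of monomials with product e.
splits : ∀ {k} → Monomial k → List (Monomial k × Monomial k)
splits []      = ([] , []) ∷ []
splits (n ∷ e) =
  cartesianProductWith (λ i (e₁ , e₂) → i ∷ e₁ , (n ∸ i) ∷ e₂) (upTo (suc n)) (splits e)

seriesRing : ℕ → RawRing 0ℓ 0ℓ
seriesRing k = record
  { Carrier = Series k
  ; _≈_     = λ f g → ∀ e → f e ≡ g e
  ; _+_     = λ f g e → f e ℤ.+ g e
  ; _*_     = λ f g e → ∑ℤ (splits e) (λ (e₁ , e₂) → f e₁ ℤ.* g e₂)
  ; -_      = λ f e → ℤ.- f e
  ; 0#      = λ _ → 0ℤ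
  ; 1#      = monomial (replicate k 0)
  }

module _ {k : ℕ} where
  open RawRing (seriesRing k) public
    using (_≈_; _+_; _*_; -_; 0#; 1#)
  open RawSemiringDefinitions (RawRing.rawSemiring (seriesRing k)) public
    using (_^_) renaming (product to ∏)

  -- Sum over a finite set, ∏ being the product over Fin.
  ∑ : {A : Set} {P : A → Set} → Enumeration P → (A → Series k) → Series k
  ∑ E = bigOp (RawRing.+-rawMonoid (seriesRing k)) (elements E)

  var : Fin k → Series k
  var i = monomial (replicate k 0 [ i ]≔ 1)

  OccursIn : Monomial k → Series k → Set
  OccursIn e f = f e ≢ 0ℤ

  -- ∑_{r ≥ 0} f^r, for f without constant term; powers with r > degree e
  -- do not contribute to the coefficient of e.  See geometric-inverse.
  1/[1-_] : Series k → Series k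
  1/[1- f ] e = ∑ℤ (upTo (suc (degree e))) (λ r → (f ^ r) e)

  -- Convergence of a (possibly infinite) sum of series: each monomial
  -- occurs in finitely many of the summands only.
  HasSum : {I : Set} → (I → Series k) → Series k → Set
  HasSum {I} F S = ∀ e → Σ[ L ∈ List I ]
    Unique L × (∀ i → OccursIn e (F i) → i ∈ L) × S e ≡ ∑ℤ L (λ i → F i e)

∑ℤ-cong : {A : Set} (xs : List A) {h h′ : A → ℤ} →
          (∀ {x} → x ∈ xs → h x ≡ h′ x) → ∑ℤ xs h ≡ ∑ℤ xs h′
∑ℤ-cong []       _  = refl
∑ℤ-cong (x ∷ xs) eq = cong₂ ℤ._+_ (eq (here refl)) (∑ℤ-cong xs (eq ∘ there))

∑ℤ-zero : {A : Set} (xs : List A) {h : A → ℤ} →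
          (∀ {x} → x ∈ xs → h x ≡ 0ℤ) → ∑ℤ xs h ≡ 0ℤ
∑ℤ-zero []       _  = refl
∑ℤ-zero (x ∷ xs) eq = cong₂ ℤ._+_ (eq (here refl)) (∑ℤ-zero xs (eq ∘ there))

∑ℤ-+ : {A : Set} (xs : List A) (h h′ : A → ℤ) →
       ∑ℤ xs (λ x → h x ℤ.+ h′ x) ≡ ∑ℤ xs h ℤ.+ ∑ℤ xs h′
∑ℤ-+ []       h h′ = refl
∑ℤ-+ (x ∷ xs) h h′ = trans (cong₂ ℤ._+_ {x = (h x ℤ.+ h′ x)} refl (∑ℤ-+ xs h h′))
  (interchange (h x) (h′ x) (∑ℤ xs h) (∑ℤ xs h′))
  where open import Algebra.Properties.CommutativeSemigroup ℤ.+-commutativeSemigroup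

∑ℤ-neg : {A : Set} (xs : List A) (h : A → ℤ) → ∑ℤ xs (λ x → ℤ.- h x) ≡ ℤ.- ∑ℤ xs h
∑ℤ-neg []       h = refl
∑ℤ-neg (x ∷ xs) h = trans (cong₂ ℤ._+_ {x = ℤ.- h x} refl (∑ℤ-neg xs h))
  (sym (ℤ.neg-distrib-+ (h x) (∑ℤ xs h)))

∑ℤ-upTo : ∀ n (h : ℕ → ℤ) → ∑ℤ (upTo (suc n)) h ≡ h 0 ℤ.+ ∑ℤ (upTo n) (h ∘ suc)
∑ℤ-upTo n h = cong (λ xs → h 0 ℤ.+ foldr ℤ._+_ 0ℤ xs)
  (trans (map-applyUpTo suc h n) (sym (map-upTo (h ∘ suc) n)))

∑ℤ-upTo-extend : ∀ {i n} (h : ℕ → ℤ) → i ≤ n → (∀ r → i ≤ r → h r ≡ 0ℤ) →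
                 ∑ℤ (upTo i) h ≡ ∑ℤ (upTo n) h
∑ℤ-upTo-extend {n = n} h z≤n h≡0 = sym (∑ℤ-zero (upTo n) (λ {r} _ → h≡0 r z≤n))
∑ℤ-upTo-extend {suc i} {suc n} h (s≤s i≤n) h≡0 = begin
  ∑ℤ (upTo (suc i)) h               ≡⟨ ∑ℤ-upTo i h ⟩
  h 0 ℤ.+ ∑ℤ (upTo i) (h ∘ suc)     ≡⟨ cong₂ ℤ._+_ {x = h 0} refl (∑ℤ-upTo-extend (h ∘ suc) i≤n (λ r → h≡0 (suc r) ∘ s≤s)) ⟩
  h 0 ℤ.+ ∑ℤ (upTo n) (h ∘ suc)     ≡⟨ ∑ℤ-upTo n h ⟨
  ∑ℤ (upTo (suc n)) h               ∎
  where open ≡-Reasoning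

splits-head : ∀ {k} (e : Monomial k) → Σ[ rest ∈ List (Monomial k × Monomial k) ]
  splits e ≡ (replicate k 0 , e) ∷ rest × (∀ {p} → p ∈ rest → replicate k 0 ≢ proj₁ p)
splits-head []      = [] , refl , λ ()
splits-head {suc k} (n ∷ e) with splits-head e
... | rest , eq , nz rewrite eq =
  first ++ later , refl , λ p∈ → nonzero (∈-++⁻ first p∈)
  where
  cons : ℕ → Monomial k × Monomial k → Monomial (suc k) × Monomial (suc k)
  cons i (e₁ , e₂) = i ∷ e₁ , (n ∸ i) ∷ e₂
  first later : List (Monomial (suc k) × Monomial (suc k))
  first = map (cons 0) rest
  later = cartesianProductWith cons (applyUpTo suc n) ((replicate k 0 , e) ∷ rest)
  nonzero : ∀ {p} → p ∈ first ⊎ p ∈ later → replicate (suc k) 0 ≢ proj₁ p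
  nonzero (inj₁ p∈) 0≡ with ∈-map⁻ (cons 0) p∈
  ... | _ , q∈ , refl = nz q∈ (Vec.∷-injectiveʳ 0≡)
  nonzero (inj₂ p∈) 0≡ with ∈-cartesianProductWith⁻ cons (applyUpTo suc n) _ p∈
  ... | _ , _ , i∈ , _ , refl with ∈-applyUpTo⁻ suc i∈
  ... | _ , _ , refl with () ← Vec.∷-injectiveˡ 0≡

degree-splits : ∀ {k} (e : Monomial k) {p} → p ∈ splits e →
                degree (proj₁ p) ℕ.+ degree (proj₂ p) ≡ degree e
degree-splits []      (here refl) = refl
degree-splits (n ∷ e) p∈
  with ∈-cartesianProductWith⁻ (λ i (e₁ , e₂) → i ∷ e₁ , (n ∸ i) ∷ e₂) (upTo (suc n)) (splits e) p∈
... | i , (e₁ , e₂) , i∈ , q∈ , refl = trans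
  (interchange i (degree e₁) (n ∸ i) (degree e₂))
  (cong₂ ℕ._+_ (ℕ.m+[n∸m]≡n (ℕ.≤-pred (∈-upTo⁻ i∈))) (degree-splits e q∈))
  where open import Algebra.Properties.CommutativeSemigroup ℕ.+-commutativeSemigroup

degree-zero : ∀ {k} (e : Monomial k) → degree e ≡ 0 → e ≡ replicate k 0
degree-zero []      _  = refl
degree-zero (n ∷ e) eq = cong₂ _∷_ (ℕ.m+n≡0⇒m≡0 n eq) (degree-zero e (ℕ.m+n≡0⇒n≡0 n eq))

*-identityˡ : ∀ {k} (f : Series k) → 1# * f ≈ f
*-identityˡ {k} f e with splits-head e
... | rest , eq , nz rewrite eq = begin
  monomial 𝟎 𝟎 ℤ.* f e ℤ.+ ∑ℤ rest (λ (e₁ , e₂) → monomial 𝟎 e₁ ℤ.* f e₂)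
    ≡⟨ cong₂ ℤ._+_ (cong (λ u → u ℤ.* f e) monomial-self) (∑ℤ-zero rest (λ p∈ → cong (λ u → u ℤ.* f _) (monomial-other (nz p∈)))) ⟩
  1ℤ ℤ.* f e ℤ.+ 0ℤ  ≡⟨ ℤ.+-identityʳ _ ⟩
  1ℤ ℤ.* f e         ≡⟨ ℤ.*-identityˡ (f e) ⟩
  f e                ∎
  where
  open ≡-Reasoning
  𝟎 = replicate k 0
  monomial-self : monomial 𝟎 𝟎 ≡ 1ℤ
  monomial-self with Vec.≡-dec _≟_ 𝟎 𝟎
  ... | yes _  = refl
  ... | no 0≢0 = contradiction refl 0≢0
  monomial-other : ∀ {e₁} → 𝟎 ≢ e₁ → monomial 𝟎 e₁ ≡ 0ℤ
  monomial-other {e₁} 0≢ with Vec.≡-dec _≟_ 𝟎 e₁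
  ... | yes 0≡ = contradiction 0≡ 0≢
  ... | no _   = refl

*-∑ℤ : ∀ {k} (f : Series k) {A : Set} (xs : List A) (h : A → Series k) →
       f * (λ e → ∑ℤ xs (λ x → h x e)) ≈ λ e → ∑ℤ xs (λ x → (f * h x) e)
*-∑ℤ f []       h e = ∑ℤ-zero (splits e) (λ {p} _ → ℤ.*-zeroʳ (f (proj₁ p)))
*-∑ℤ f (x ∷ xs) h e = begin
  ∑ℤ (splits e) (λ (e₁ , e₂) → f e₁ ℤ.* (h x e₂ ℤ.+ s e₂))
    ≡⟨ ∑ℤ-cong (splits e) (λ {(e₁ , e₂)} _ → ℤ.*-distribˡ-+ (f e₁) (h x e₂) (s e₂)) ⟩
  ∑ℤ (splits e) (λ (e₁ , e₂) → f e₁ ℤ.* h x e₂ ℤ.+ f e₁ ℤ.* s e₂)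
    ≡⟨ ∑ℤ-+ (splits e) _ _ ⟩
  (f * h x) e ℤ.+ (f * s) e
    ≡⟨ cong₂ ℤ._+_ {x = (f * h x) e} refl (*-∑ℤ f xs h e) ⟩
  (f * h x) e ℤ.+ ∑ℤ xs (λ y → (f * h y) e) ∎
  where
  open ≡-Reasoning
  s = λ e → ∑ℤ xs (λ y → h y e)

module _ {k : ℕ} (f : Series k) (f₀≡0 : f (replicate k 0) ≡ 0ℤ) where
  open ≡-Reasoning

  -- In a split of e with f e₁ ≠ 0, the second part has smaller degree.
  *-cong-smaller : ∀ {h h′ : Series k} e → (∀ e₂ → degree e₂ < degree e → h e₂ ≡ h′ e₂) →
                   (f * h) e ≡ (f * h′) e
  *-cong-smaller {h} {h′} e eq = ∑ℤ-cong (splits e) step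
    where
    step : ∀ {p} → p ∈ splits e → f (proj₁ p) ℤ.* h (proj₂ p) ≡ f (proj₁ p) ℤ.* h′ (proj₂ p)
    step {e₁ , e₂} p∈ with degree e₁ in deg | degree-splits e p∈
    ... | zero  | _   rewrite degree-zero e₁ deg | f₀≡0 = refl
    ... | suc n | sum = cong₂ ℤ._*_ {x = f e₁} refl (eq e₂ (subst (degree e₂ <_) sum (s≤s (ℕ.m≤n+m _ n))))

  ^-vanishes : ∀ r e → degree e < r → (f ^ r) e ≡ 0ℤ
  ^-vanishes (suc r) e (s≤s deg≤r) = trans
    (*-cong-smaller {h′ = 0#} e (λ e₂ deg< → ^-vanishes r e₂ (ℕ.<-≤-trans deg< deg≤r)))
    (∑ℤ-zero (splits e) (λ {p} _ → ℤ.*-zeroʳ (f (proj₁ p))))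

  geometric-inverse : (1# + - f) * 1/[1- f ] ≈ 1#
  geometric-inverse e = begin
    ((1# + - f) * G) e
      ≡⟨ ∑ℤ-cong (splits e) (λ {(e₁ , e₂)} _ → expand (1# e₁) (f e₁) (G e₂)) ⟩
    ∑ℤ (splits e) (λ (e₁ , e₂) → 1# e₁ ℤ.* G e₂ ℤ.+ ℤ.- (f e₁ ℤ.* G e₂))
      ≡⟨ ∑ℤ-+ (splits e) _ _ ⟩
    (1# * G) e ℤ.+ ∑ℤ (splits e) (λ (e₁ , e₂) → ℤ.- (f e₁ ℤ.* G e₂))
      ≡⟨ cong₂ ℤ._+_ (trans (*-identityˡ G e) (∑ℤ-upTo N (λ r → (f ^ r) e)))
                     (trans (∑ℤ-neg (splits e) _) (cong ℤ.-_ f*G)) ⟩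
    (1# e ℤ.+ T) ℤ.+ ℤ.- T
      ≡⟨ ℤ.+-assoc (1# e) T (ℤ.- T) ⟩
    1# e ℤ.+ (T ℤ.+ ℤ.- T)
      ≡⟨ cong₂ ℤ._+_ {x = 1# {k} e} refl (ℤ.+-inverseʳ T) ⟩
    1# e ℤ.+ 0ℤ
      ≡⟨ ℤ.+-identityʳ _ ⟩
    1# e ∎
    where
    G = 1/[1- f ]
    N = degree e
    T = ∑ℤ (upTo N) (λ r → (f ^ suc r) e)
    expand : ∀ u v w → (u ℤ.+ ℤ.- v) ℤ.* w ≡ u ℤ.* w ℤ.+ ℤ.- (v ℤ.* w)
    expand u v w = trans (ℤ.*-distribʳ-+ w u (ℤ.- v))
      (cong₂ ℤ._+_ {x = u ℤ.* w} refl (sym (ℤ.neg-distribˡ-* v w)))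
    f*G : (f * G) e ≡ T
    f*G = trans
      (*-cong-smaller {h = G} {h′ = λ e₂ → ∑ℤ (upTo N) (λ r → (f ^ r) e₂)} e
        (λ e₂ deg< → ∑ℤ-upTo-extend (λ r → (f ^ r) e₂) deg< (λ r → ^-vanishes r e₂)))
      (*-∑ℤ f (upTo N) (f ^_) e)

------------------------------------------------------------------------
-- The polynomials

-- Finite families indexed from 0 and extended to ℕ; in the sums below
-- only indices < n occur, so the value 1# is never used.
_at_ : ∀ {n k} → (Fin n → Series k) → ℕ → Series k
_at_ {n} y i with i <? n
... | yes i<n = y (fromℕ< i<n)
... | no  _   = 1#

-- Since y_v is y (v - 1), the variable z_{π_ij} is z at pred (entry π i j).
weight : ∀ {n m k} → (Fin n → Series k) → (Fin m → Series k) → Array → Series k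
weight {k = k} x z π = bigOp (RawRing.*-rawMonoid (seriesRing k)) (Des π)
  λ (i , j) → (x at i) * (z at pred (entry π i j))

g : ∀ {n m k} → Partition → (Fin n → Series k) → (Fin m → Series k) → Series k
g {n} {m} p x z = ∑ (PP-ofShape n m p) (weight x z)

schur : ∀ {m k} → Partition → (Fin m → Series k) → Series k
schur {m} p z = ∑ (columnStrictPlanePartitions m p) λ π →
  ∏ λ i → z i ^ a π (suc (toℕ i))

dualGrothendieck : ∀ {m k} → Partition → (Fin m → Series k) → Series k
dualGrothendieck {m} p z = ∑ (planePartitions m p) λ π →
  ∏ λ i → z i ^ c π (suc (toℕ i))

{-# OPTIONS --safe #-}

-- For a plane partition π with at most n rows and entries at most m, let
-- D i v be the number of descents in row i with entry v.  Row i is recovered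
-- from row i + 1 and the word of its own descents by a merge, so π ↦ D is a
-- bijection onto all n × m matrices, and it carries the weight of π to
-- ∏ (x i * z v) ^ D i v.  Summing over D gives the Cauchy identity.  Row sums
-- of D are the d i; column sums are the c v, because a column containing v has
-- exactly one descent with entry v.  So the weight of π has degree
-- 2 (number of descents) ≤ 2 |λ|, with equality iff π is column-strict.
module Submission where

open import Defs

import Data.Nat.Properties as ℕ
open import Algebra.Properties.CommutativeMonoid.Sum ℕ.+-0-commutativeMonoid
  using (sum; sum-cong-≗; ∑-distrib-+; ∑-comm; sum-replicate-zero)
open import Algebra.Properties.Semiring.Sum ℕ.+-*-semiring using (*-distribʳ-sum)
open import Data.Bool.Base using (true; false)
open import Data.Fin.Base as Fin using (Fin; zero; suc; toℕ; fromℕ<; _↑ˡ_; _↑ʳ_)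
import Data.Fin.Properties as Fin
open import Data.Integer.Base as ℤ using (ℤ; 0ℤ; 1ℤ)
import Data.Integer.Properties as ℤ
open import Data.List.Base as List
  using (List; []; _∷_; length; map; filter; concat; concatMap; upTo; applyUpTo; cartesianProductWith; deduplicate)
import Data.List.Properties as List
open import Data.List.Membership.DecPropositional ℕ._≟_ using (_∈?_)
open import Data.List.Membership.Propositional using (_∈_; find; lose)
open import Data.List.Membership.Propositional.Properties
open import Data.List.Membership.Propositional.Properties.WithK using (unique∧set⇒bag)
open import Data.List.Relation.Binary.BagAndSetEquality using (∼bag⇒↭)
open import Data.List.Relation.Binary.Disjoint.Propositional using (Disjoint)
open import Data.List.Relation.Binary.Permutation.Propositional using (_↭_; ↭⇒↭ₛ)
import Data.List.Relation.Binary.Permutation.Propositional.Properties as ↭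
open import Data.List.Relation.Binary.Permutation.Setoid.Properties using (foldr-commMonoid)
open import Data.List.Relation.Unary.All as All using (All; []; _∷_)
import Data.List.Relation.Unary.All.Properties as All
open import Data.List.Relation.Unary.AllPairs as AllPairs using (AllPairs; []; _∷_)
import Data.List.Relation.Unary.AllPairs.Properties as AllPairs
open import Data.List.Relation.Unary.Any using (here; there)
open import Data.List.Relation.Unary.Linked using (Linked; []; [-]; _∷_)
import Data.List.Relation.Unary.Unique.DecPropositional.Properties as DecUnique
open import Data.List.Relation.Unary.Unique.Propositional using (Unique)
import Data.List.Relation.Unary.Unique.Propositional.Properties as Unique
open import Data.Nat.Base as ℕ using (ℕ; zero; suc; pred; _∸_; _≤_; _<_; _≥_; z≤n; s≤s; s≤s⁻¹)
import Data.Nat.ListAction as ℕ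
import Data.Nat.ListAction.Properties as ℕ
open import Data.Nat.Properties using (_<?_)
open import Data.Product.Base using (Σ-syntax; ∃-syntax; _×_; _,_; proj₁; proj₂)
open import Data.Sum.Base using (_⊎_; inj₁; inj₂)
open import Data.Vec.Base as Vec using (Vec; []; _∷_; _++_; lookup; tabulate; replicate; zipWith; _[_]%=_)
import Data.Vec.Properties as Vec
open import Function.Base using (_∘_)
open import Function.Bundles using (mk⇔)
open import Relation.Binary.Definitions using (DecidableEquality)
open import Relation.Binary.PropositionalEquality
open import Relation.Nullary using (Dec; yes; no; ¬_; ¬?; contradiction)
open import Relation.Nullary.Decidable using (_×-dec_; map′)
open import Relation.Unary using (Decidable)

-- Sums of integers

-- The merge is forced by monotonicity. So comparing the next letter with the entry below settles
-- every column. Series are coefficient functions, hence each identity is checked at one exponent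
-- vector `e`. Every weight is a single monomial, and the lists to be compared usually differ by
-- objects whose weight is not `e`: arrays that are not column-strict in (i), arrays outside a
-- finite box of matrices in (iv). Comparisons of lists therefore look at nonzero terms only, as in
-- `∑ℤ-support`. The same principle truncates the geometric series and the sum over all partitions:
-- a matrix contributing to `e` has entries at most `degree e`. The weight is computed with
-- arbitrary monomials in place of the variables, which covers both the separate variables of (i),
-- (ii), (iv) and the value 1 in (iii).

∑ℤ-↭ : {A : Set} {xs ys : List A} (h : A → ℤ) → xs ↭ ys → ∑ℤ xs h ≡ ∑ℤ ys h
∑ℤ-↭ h p = foldr-commMonoid (setoid ℤ) ℤ.+-0-isCommutativeMonoid (↭⇒↭ₛ (↭.map⁺ h p))

∑ℤ-map : {A B : Set} (f : A → B) (h : B → ℤ) (xs : List A) → ∑ℤ (map f xs) h ≡ ∑ℤ xs (h ∘ f)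
∑ℤ-map f h xs = cong (List.foldr ℤ._+_ 0ℤ) (sym (List.map-∘ xs))

∑ℤ-++ : {A : Set} (xs ys : List A) (h : A → ℤ) → ∑ℤ (xs List.++ ys) h ≡ ∑ℤ xs h ℤ.+ ∑ℤ ys h
∑ℤ-++ []       ys h = sym (ℤ.+-identityˡ _)
∑ℤ-++ (x ∷ xs) ys h = trans (cong (ℤ._+_ (h x)) (∑ℤ-++ xs ys h)) (sym (ℤ.+-assoc (h x) _ _))

∑ℤ-concatMap : {A B : Set} (f : A → List B) (h : B → ℤ) (xs : List A) →
               ∑ℤ (concatMap f xs) h ≡ ∑ℤ xs (λ x → ∑ℤ (f x) h)
∑ℤ-concatMap f h []       = refl
∑ℤ-concatMap f h (x ∷ xs) = trans (∑ℤ-++ (f x) _ h) (cong (ℤ._+_ (∑ℤ (f x) h)) (∑ℤ-concatMap f h xs))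

∑ℤ-cartesianProductWith : {A B C : Set} (f : A → B → C) (h : C → ℤ) (xs : List A) (ys : List B) →
  ∑ℤ (cartesianProductWith f xs ys) h ≡ ∑ℤ xs (λ x → ∑ℤ ys (λ y → h (f x y)))
∑ℤ-cartesianProductWith f h []       ys = refl
∑ℤ-cartesianProductWith f h (x ∷ xs) ys = trans (∑ℤ-++ (map (f x) ys) _ h)
  (cong₂ ℤ._+_ (∑ℤ-map (f x) h ys) (∑ℤ-cartesianProductWith f h xs ys))

∑ℤ-filter : {A : Set} (h : A → ℤ) (xs : List A) →
            ∑ℤ (filter (λ x → ¬? (h x ℤ.≟ 0ℤ)) xs) h ≡ ∑ℤ xs h
∑ℤ-filter h []       = refl
∑ℤ-filter h (x ∷ xs) with h x ℤ.≟ 0ℤ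
... | yes hx≡0 = trans (∑ℤ-filter h xs)
  (sym (trans (cong (λ u → u ℤ.+ ∑ℤ xs h) hx≡0) (ℤ.+-identityˡ _)))
... | no  _    = cong (ℤ._+_ (h x)) (∑ℤ-filter h xs)

-- After the zero terms are filtered out, both lists are repetition-free with the same members,
-- hence permutations of each other.
∑ℤ-support : {A : Set} {xs ys : List A} (h : A → ℤ) → Unique xs → Unique ys →
             (∀ {x} → x ∈ xs → h x ≢ 0ℤ → x ∈ ys) → (∀ {x} → x ∈ ys → h x ≢ 0ℤ → x ∈ xs) →
             ∑ℤ xs h ≡ ∑ℤ ys h
∑ℤ-support {A} {xs} {ys} h xs! ys! xs⊆ys ys⊆xs = begin
  ∑ℤ xs h             ≡⟨ ∑ℤ-filter h xs ⟨
  ∑ℤ (filter nz? xs) h ≡⟨ ∑ℤ-↭ h (∼bag⇒↭ (unique∧set⇒bag (Unique.filter⁺ nz? xs!) (Unique.filter⁺ nz? ys!)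
                            (mk⇔ (transfer xs⊆ys) (transfer ys⊆xs)))) ⟩
  ∑ℤ (filter nz? ys) h ≡⟨ ∑ℤ-filter h ys ⟩
  ∑ℤ ys h             ∎
  where
  open ≡-Reasoning
  nz? = λ x → ¬? (h x ℤ.≟ 0ℤ)
  transfer : ∀ {us vs} → (∀ {x} → x ∈ us → h x ≢ 0ℤ → x ∈ vs) →
             ∀ {x} → x ∈ filter nz? us → x ∈ filter nz? vs
  transfer us⊆vs x∈ = let (x∈us , hx≢0) = ∈-filter⁻ nz? x∈ in ∈-filter⁺ nz? (us⊆vs x∈us hx≢0) hx≢0

-- Yields a plane partition responsible for a given monomial of `g`.
∑ℤ-nonzero : {A : Set} (xs : List A) {h : A → ℤ} → ∑ℤ xs h ≢ 0ℤ → ∃[ x ] x ∈ xs × h x ≢ 0ℤ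
∑ℤ-nonzero []       ≢0 = contradiction refl ≢0
∑ℤ-nonzero (x ∷ xs) {h} ≢0 with h x ℤ.≟ 0ℤ
... | no  hx≢0 = x , here refl , hx≢0
... | yes hx≡0 = let (y , y∈ , hy≢0) = ∑ℤ-nonzero xs rest≢0 in y , there y∈ , hy≢0
  where
  rest≢0 : ∑ℤ xs h ≢ 0ℤ
  rest≢0 rest≡0 = ≢0 (cong₂ ℤ._+_ hx≡0 rest≡0)

-- Monomials

monomial-self : ∀ {k} (e : Monomial k) → monomial e e ≡ 1ℤ
monomial-self e with Vec.≡-dec ℕ._≟_ e e
... | yes _  = refl
... | no e≢e = contradiction refl e≢e

monomial-other : ∀ {k} {e e′ : Monomial k} → e ≢ e′ → monomial e e′ ≡ 0ℤ
monomial-other {e = e} {e′} e≢ with Vec.≡-dec ℕ._≟_ e e′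
... | yes e≡ = contradiction e≡ e≢
... | no _   = refl

monomial-occurs : ∀ {k} {e e′ : Monomial k} → monomial e e′ ≢ 0ℤ → e ≡ e′
monomial-occurs {e = e} {e′} ≢0 with Vec.≡-dec ℕ._≟_ e e′
... | yes e≡ = e≡
... | no _   = contradiction refl ≢0

splits-unique : ∀ {k} (e : Monomial k) → Unique (splits e)
splits-unique []      = [] ∷ []
splits-unique (n ∷ e) = Unique.cartesianProductWith⁺ _ injective (Unique.upTo⁺ (suc n)) (splits-unique e)
  where
  injective : ∀ {i j p q} → (i ∷ proj₁ p , (n ∸ i) ∷ proj₂ p) ≡ (j ∷ proj₁ q , (n ∸ j) ∷ proj₂ q) →
              i ≡ j × p ≡ q
  injective refl = refl , refl

splits-sound : ∀ {k} (e : Monomial k) {p} → p ∈ splits e → zipWith ℕ._+_ (proj₁ p) (proj₂ p) ≡ e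
splits-sound []      (here refl) = refl
splits-sound (n ∷ e) p∈
  with ∈-cartesianProductWith⁻ (λ i (e₁ , e₂) → i ∷ e₁ , (n ∸ i) ∷ e₂) (upTo (suc n)) (splits e) p∈
... | i , _ , i∈ , q∈ , refl = cong₂ _∷_ (ℕ.m+[n∸m]≡n (ℕ.≤-pred (∈-upTo⁻ i∈))) (splits-sound e q∈)

splits-complete : ∀ {k} (e₁ e₂ : Monomial k) → (e₁ , e₂) ∈ splits (zipWith ℕ._+_ e₁ e₂)
splits-complete []       []       = here refl
splits-complete (i ∷ e₁) (j ∷ e₂) =
  subst (λ l → (i ∷ e₁ , l ∷ e₂) ∈ splits (zipWith ℕ._+_ (i ∷ e₁) (j ∷ e₂))) (ℕ.m+n∸m≡n i j)
    (∈-cartesianProductWith⁺ (λ l (e₁ , e₂) → l ∷ e₁ , (i ℕ.+ j ∸ l) ∷ e₂)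
      (∈-upTo⁺ (s≤s (ℕ.m≤m+n i j))) (splits-complete e₁ e₂))

-- Only the split `(u , v)` can contribute, and it is a split of `e` precisely when `e` is the sum
-- of the two vectors.
monomial-* : ∀ {k} (u v : Monomial k) → monomial u * monomial v ≈ monomial (zipWith ℕ._+_ u v)
monomial-* u v e with Vec.≡-dec ℕ._≟_ (zipWith ℕ._+_ u v) e
... | yes refl = begin
  ∑ℤ (splits e) h   ≡⟨ ∑ℤ-support h (splits-unique e) ([] ∷ []) only (λ { (here refl) _ → splits-complete u v }) ⟩
  h (u , v) ℤ.+ 0ℤ  ≡⟨ ℤ.+-identityʳ _ ⟩
  h (u , v)         ≡⟨ cong₂ ℤ._*_ (monomial-self u) (monomial-self v) ⟩
  1ℤ                ∎
  where
  open ≡-Reasoning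
  h : Monomial _ × Monomial _ → ℤ
  h (e₁ , e₂) = monomial u e₁ ℤ.* monomial v e₂
  only : ∀ {p} → p ∈ splits e → h p ≢ 0ℤ → p ∈ (u , v) ∷ []
  only {e₁ , e₂} _ ≢0
    with refl ← monomial-occurs {e = u} {e₁} (λ ≡0 → ≢0 (cong (ℤ._* monomial v e₂) ≡0))
       | refl ← monomial-occurs {e = v} {e₂} (λ ≡0 → ≢0 (trans (cong (monomial u e₁ ℤ.*_) ≡0) (ℤ.*-zeroʳ (monomial u e₁))))
    = here refl
... | no u+v≢e = ∑ℤ-zero (splits e) vanishes
  where
  vanishes : ∀ {p} → p ∈ splits e → monomial u (proj₁ p) ℤ.* monomial v (proj₂ p) ≡ 0ℤ
  vanishes {e₁ , e₂} p∈ with Vec.≡-dec ℕ._≟_ u e₁ | Vec.≡-dec ℕ._≟_ v e₂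
  ... | yes refl | yes refl = contradiction (splits-sound e p∈) u+v≢e
  ... | yes _    | no  _    = refl
  ... | no  _    | _        = refl

*-cong : ∀ {k} {F F′ G G′ : Series k} → F ≈ F′ → G ≈ G′ → F * G ≈ F′ * G′
*-cong F≈ G≈ e = ∑ℤ-cong (splits e) (λ {p} _ → cong₂ ℤ._*_ (F≈ (proj₁ p)) (G≈ (proj₂ p)))

∑ℤ-* : ∀ {k} (F : Series k) {A : Set} (xs : List A) (h : A → Series k) →
       (λ e → ∑ℤ xs (λ x → h x e)) * F ≈ λ e → ∑ℤ xs (λ x → (h x * F) e)
∑ℤ-* F []       h e = ∑ℤ-zero (splits e) (λ {p} _ → ℤ.*-zeroˡ (F (proj₂ p)))
∑ℤ-* F (x ∷ xs) h e = begin
  ∑ℤ (splits e) (λ (e₁ , e₂) → (h x e₁ ℤ.+ s e₁) ℤ.* F e₂)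
    ≡⟨ ∑ℤ-cong (splits e) (λ {(e₁ , e₂)} _ → ℤ.*-distribʳ-+ (F e₂) (h x e₁) (s e₁)) ⟩
  ∑ℤ (splits e) (λ (e₁ , e₂) → h x e₁ ℤ.* F e₂ ℤ.+ s e₁ ℤ.* F e₂)
    ≡⟨ ∑ℤ-+ (splits e) _ _ ⟩
  (h x * F) e ℤ.+ (s * F) e
    ≡⟨ cong (ℤ._+_ ((h x * F) e)) (∑ℤ-* F xs h e) ⟩
  (h x * F) e ℤ.+ ∑ℤ xs (λ y → (h y * F) e) ∎
  where
  open ≡-Reasoning
  s = λ e → ∑ℤ xs (λ y → h y e)

-- Sums over enumerated sets

∑-coefficient : ∀ {k} {A : Set} {P : A → Set} (E : Enumeration P) (F : A → Series k) e →
                ∑ E F e ≡ ∑ℤ (elements E) (λ x → F x e)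
∑-coefficient {k} {A} E F e = go (elements E)
  where
  go : (xs : List A) → bigOp (record { Carrier = Series k ; _≈_ = _≈_ ; _∙_ = _+_ ; ε = 0# }) xs F e
                        ≡ ∑ℤ xs (λ x → F x e)
  go []       = refl
  go (x ∷ xs) = cong (ℤ._+_ (F x e)) (go xs)

∑-*-distribˡ : ∀ {k} {A : Set} {P : A → Set} (E : Enumeration P) (G : Series k) (F : A → Series k) →
               G * ∑ E F ≈ ∑ E (λ x → G * F x)
∑-*-distribˡ E G F e = begin
  (G * ∑ E F) e                                  ≡⟨ *-cong {F = G} (λ _ → refl) (∑-coefficient E F) e ⟩
  (G * (λ e → ∑ℤ (elements E) (λ x → F x e))) e  ≡⟨ *-∑ℤ G (elements E) F e ⟩
  ∑ℤ (elements E) (λ x → (G * F x) e)            ≡⟨ ∑-coefficient E (λ x → G * F x) e ⟨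
  ∑ E (λ x → G * F x) e                          ∎
  where open ≡-Reasoning

∑-cong : ∀ {k} {A : Set} {P : A → Set} (E : Enumeration P) {F F′ : A → Series k} →
         (∀ {x} → P x → F x ≈ F′ x) → ∑ E F ≈ ∑ E F′
∑-cong E {F} {F′} F≈ e = begin
  ∑ E F e                          ≡⟨ ∑-coefficient E F e ⟩
  ∑ℤ (elements E) (λ x → F x e)    ≡⟨ ∑ℤ-cong (elements E) (λ x∈ → F≈ (Enumeration.sound E x∈) e) ⟩
  ∑ℤ (elements E) (λ x → F′ x e)   ≡⟨ ∑-coefficient E F′ e ⟨
  ∑ E F′ e                         ∎
  where open ≡-Reasoning

-- Since `e` is fixed, the hypotheses may exploit its degree; this is how strictness enters in top
-- degree.
∑-support : ∀ {k} {A : Set} {P Q : A → Set} (E : Enumeration P) (E′ : Enumeration Q) (F : A → Series k) e →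
            (∀ {x} → P x → F x e ≢ 0ℤ → Q x) → (∀ {x} → Q x → F x e ≢ 0ℤ → P x) →
            ∑ E F e ≡ ∑ E′ F e
∑-support E E′ F e P⇒Q Q⇒P = begin
  ∑ E F e                         ≡⟨ ∑-coefficient E F e ⟩
  ∑ℤ (elements E) (λ x → F x e)   ≡⟨ ∑ℤ-support _ (unique E) (unique E′)
                                      (λ x∈ ≢0 → complete E′ (P⇒Q (sound E x∈) ≢0))
                                      (λ x∈ ≢0 → complete E (Q⇒P (sound E′ x∈) ≢0)) ⟩
  ∑ℤ (elements E′) (λ x → F x e)  ≡⟨ ∑-coefficient E′ F e ⟨
  ∑ E′ F e                        ∎
  where
  open ≡-Reasoning
  open Enumeration using (unique; sound; complete)

-- Exponents given as functions, which turns identities between monomials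
-- into pointwise identities in ℕ.
mon : ∀ {k} → (Fin k → ℕ) → Series k
mon f = monomial (tabulate f)

mon-cong : ∀ {k} {f f′ : Fin k → ℕ} → f ≗ f′ → mon f ≈ mon f′
mon-cong f≗ e = cong (λ u → monomial u e) (Vec.tabulate-cong f≗)

mon-lookup : ∀ {k} (e : Monomial k) → monomial e ≈ mon (lookup e)
mon-lookup e e′ = cong (λ u → monomial u e′) (sym (Vec.tabulate∘lookup e))

zipWith-tabulate : ∀ {k} (f f′ : Fin k → ℕ) →
                   zipWith ℕ._+_ (tabulate f) (tabulate f′) ≡ tabulate (λ t → f t ℕ.+ f′ t)
zipWith-tabulate {zero}  f f′ = refl
zipWith-tabulate {suc k} f f′ = cong (f zero ℕ.+ f′ zero ∷_) (zipWith-tabulate (f ∘ suc) (f′ ∘ suc))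

1-mon : ∀ {k} → 1# ≈ mon {k} (λ _ → 0)
1-mon {k} e = trans (mon-lookup (replicate k 0) e) (mon-cong (λ t → Vec.lookup-replicate t 0) e)

-- Kronecker delta, read off from the vector inside `var` so that `var-mon` is an instance of
-- `mon-lookup`.
δ : ∀ {k} → Fin k → Fin k → ℕ
δ i t = lookup (replicate _ 0 Vec.[ i ]≔ 1) t

δ-same : ∀ {k} (i : Fin k) → δ i i ≡ 1
δ-same i = Vec.lookup∘update i (replicate _ 0) 1

δ-other : ∀ {k} {i t : Fin k} → t ≢ i → δ i t ≡ 0
δ-other {i = i} {t} t≢i = trans (Vec.lookup∘update′ t≢i (replicate _ 0) 1) (Vec.lookup-replicate t 0)

var-mon : ∀ {k} (i : Fin k) → var i ≈ mon (δ i)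
var-mon {k} i = mon-lookup (replicate k 0 Vec.[ i ]≔ 1)

*-mon : ∀ {k} {F G : Series k} {f h} → F ≈ mon f → G ≈ mon h → F * G ≈ mon (λ t → f t ℕ.+ h t)
*-mon {F = F} {G} {f} {h} F≈ G≈ e = begin
  (F * G) e                                            ≡⟨ *-cong F≈ G≈ e ⟩
  (mon f * mon h) e                                    ≡⟨ monomial-* (tabulate f) (tabulate h) e ⟩
  monomial (zipWith ℕ._+_ (tabulate f) (tabulate h)) e  ≡⟨ cong (λ u → monomial u e) (zipWith-tabulate f h) ⟩
  mon (λ t → f t ℕ.+ h t) e                            ∎
  where open ≡-Reasoning

^-mon : ∀ {k} {F : Series k} {f} → F ≈ mon f → ∀ r → F ^ r ≈ mon (λ t → r ℕ.* f t)
^-mon F≈ zero    = 1-mon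
^-mon F≈ (suc r) = *-mon F≈ (^-mon F≈ r)

∏-mon : ∀ {k} n {F : Fin n → Series k} {f : Fin n → Fin k → ℕ} → (∀ i → F i ≈ mon (f i)) →
        ∏ F ≈ mon (λ t → sum (λ i → f i t))
∏-mon zero    F≈ = 1-mon
∏-mon (suc n) F≈ = *-mon (F≈ zero) (∏-mon n (F≈ ∘ suc))

∏ˡ-mon : ∀ {k} {A : Set} (xs : List A) {F : A → Series k} {f : A → Fin k → ℕ} →
         (∀ {x} → x ∈ xs → F x ≈ mon (f x)) →
         bigOp (record { Carrier = Series k ; _≈_ = _≈_ ; _∙_ = _*_ ; ε = 1# }) xs F
           ≈ mon (λ t → ℕ.sum (map (λ x → f x t) xs))
∏ˡ-mon []       F≈ = 1-mon
∏ˡ-mon (x ∷ xs) F≈ = *-mon (F≈ (here refl)) (∏ˡ-mon xs (F≈ ∘ there))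

lookup≤degree : ∀ {k} (e : Monomial k) t → lookup e t ≤ degree e
lookup≤degree (n ∷ e) zero    = ℕ.m≤m+n n _
lookup≤degree (n ∷ e) (suc t) = ℕ.≤-trans (lookup≤degree e t) (ℕ.m≤n+m _ n)

-- Series as sums of monomials

-- F is the sum of the monomials w a over a possibly infinite family; the
-- finite part  box N  accounts for all terms of degree < N.
SumsOver : ∀ {k} {A : Set} → (ℕ → List A) → (A → Fin k → ℕ) → Series k → Set
SumsOver box w F = ∀ N e → degree e < N → F e ≡ ∑ℤ (box N) (λ x → mon (w x) e)

-- Both parts of a split of `e` have degree at most `degree e`, so one bound `N` is valid for both
-- factors at once. Requiring only `degree e < N` in `SumsOver` is what allows this common bound.
*-sumsOver : ∀ {k} {A B C : Set} {box : ℕ → List A} {box′ : ℕ → List B} {w : A → Fin k → ℕ} {w′ : B → Fin k → ℕ}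
             {F G : Series k} (pair : A → B → C) {w″ : C → Fin k → ℕ} →
             (∀ x y t → w x t ℕ.+ w′ y t ≡ w″ (pair x y) t) →
             SumsOver box w F → SumsOver box′ w′ G →
             SumsOver (λ N → cartesianProductWith pair (box N) (box′ N)) w″ (F * G)
*-sumsOver {box = box} {box′} {w} {w′} {F} {G} pair {w″} w+w′ SF SG N e deg< = begin
  (F * G) e
    ≡⟨ ∑ℤ-cong (splits e) (λ {(e₁ , e₂)} p∈ → cong₂ ℤ._*_ (SF N e₁ (small₁ p∈)) (SG N e₂ (small₂ p∈))) ⟩
  ((λ e → ∑ℤ (box N) (λ x → mon (w x) e)) * H) e
    ≡⟨ ∑ℤ-* H (box N) (λ x → mon (w x)) e ⟩
  ∑ℤ (box N) (λ x → (mon (w x) * H) e)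
    ≡⟨ ∑ℤ-cong (box N) (λ {x} _ → trans (*-∑ℤ (mon (w x)) (box′ N) (λ y → mon (w′ y)) e)
         (∑ℤ-cong (box′ N) (λ {y} _ → trans (*-mon {f = w x} {w′ y} (λ _ → refl) (λ _ → refl) e) (mon-cong (w+w′ x y) e)))) ⟩
  ∑ℤ (box N) (λ x → ∑ℤ (box′ N) (λ y → mon (w″ (pair x y)) e))
    ≡⟨ ∑ℤ-cartesianProductWith pair (λ z → mon (w″ z) e) (box N) (box′ N) ⟨
  ∑ℤ (cartesianProductWith pair (box N) (box′ N)) (λ z → mon (w″ z) e) ∎
  where
  open ≡-Reasoning
  H = λ e → ∑ℤ (box′ N) (λ y → mon (w′ y) e)
  small₁ : ∀ {p} → p ∈ splits e → degree (proj₁ p) < N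
  small₁ p∈ = ℕ.≤-<-trans (ℕ.≤-trans (ℕ.m≤m+n _ _) (ℕ.≤-reflexive (degree-splits e p∈))) deg<
  small₂ : ∀ {p} → p ∈ splits e → degree (proj₂ p) < N
  small₂ {p} p∈ = ℕ.≤-<-trans (ℕ.≤-trans (ℕ.m≤n+m _ (degree (proj₁ p))) (ℕ.≤-reflexive (degree-splits e p∈))) deg<

vectors : {A : Set} → List A → ∀ n → List (Vec A n)
vectors xs zero    = [] ∷ []
vectors xs (suc n) = cartesianProductWith _∷_ xs (vectors xs n)

vectors-unique : {A : Set} {xs : List A} → Unique xs → ∀ n → Unique (vectors xs n)
vectors-unique xs! zero    = [] ∷ []
vectors-unique xs! (suc n) = Unique.cartesianProductWith⁺ _∷_ Vec.∷-injective xs! (vectors-unique xs! n)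

vectors-complete : {A : Set} {xs : List A} {n : ℕ} (v : Vec A n) → (∀ i → lookup v i ∈ xs) → v ∈ vectors xs n
vectors-complete []      _  = here refl
vectors-complete (x ∷ v) ∈xs = ∈-cartesianProductWith⁺ _∷_ (∈xs zero) (vectors-complete v (∈xs ∘ suc))

-- Expanding the product picks one term from each factor, so the terms are indexed by vectors.
∏-sumsOver : ∀ {k} {A : Set} {box : ℕ → List A} n {w : Fin n → A → Fin k → ℕ} {F : Fin n → Series k} →
             (∀ i → SumsOver box (w i) (F i)) →
             SumsOver (λ N → vectors (box N) n) (λ v t → sum (λ i → w i (lookup v i) t)) (∏ F)
∏-sumsOver zero    SF N e _ = trans (1-mon e) (sym (ℤ.+-identityʳ _))
∏-sumsOver {A = A} {box} (suc n) {w} SF = *-sumsOver {A = A} {Vec A n} {Vec A (suc n)} {box} {λ N → vectors (box N) n}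
  {w zero} {λ v t → sum (λ i → w (suc i) (lookup v i) t)} _∷_ {λ v t → sum (λ i → w i (lookup v i) t)} (λ _ _ _ → refl)
  (SF zero) (∏-sumsOver {box = box} n {w ∘ suc} (SF ∘ suc))

-- A nonzero exponent at `t` removes the constant term, so powers beyond the degree vanish at `e`
-- and the sum that defines the series may be extended up to `N`.
geometric-sumsOver : ∀ {k} {F : Series k} {f} → F ≈ mon f → (t : Fin k) → f t ≢ 0 →
                     SumsOver upTo (λ r t → r ℕ.* f t) 1/[1- F ]
geometric-sumsOver {k} {F} {f} F≈ t ft≢0 N e deg< = begin
  ∑ℤ (upTo (suc (degree e))) (λ r → (F ^ r) e)
    ≡⟨ ∑ℤ-upTo-extend (λ r → (F ^ r) e) deg< (λ r → ^-vanishes F F₀≡0 r e) ⟩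
  ∑ℤ (upTo N) (λ r → (F ^ r) e)
    ≡⟨ ∑ℤ-cong (upTo N) (λ {r} _ → ^-mon F≈ r e) ⟩
  ∑ℤ (upTo N) (λ r → mon (λ t → r ℕ.* f t) e) ∎
  where
  open ≡-Reasoning
  F₀≡0 : F (replicate k 0) ≡ 0ℤ
  F₀≡0 = trans (F≈ _) (monomial-other {e = tabulate f} {replicate k 0} (λ eq → ft≢0
    (trans (sym (Vec.lookup∘tabulate f t)) (trans (cong (λ v → lookup v t) eq) (Vec.lookup-replicate t 0)))))

-- Rows and their descents

filter-map : {A B : Set} {P : B → Set} (P? : Decidable P) (f : A → B) (xs : List A) →
             filter P? (map f xs) ≡ map f (filter (P? ∘ f) xs)
filter-map P? f []       = refl
filter-map P? f (x ∷ xs) with P? (f x)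
... | yes _ = cong (f x ∷_) (filter-map P? f xs)
... | no  _ = filter-map P? f xs

-- `AllPairs` instead of `Linked`: a merge makes entries adjacent that were not so before, so each
-- head has to bound the whole tail.
Sorted : List ℕ → Set
Sorted = AllPairs _≥_

count : ℕ → List ℕ → ℕ
count v u = length (filter (ℕ._≟ v) u)

‼-All : {P : ℕ → Set} {r : List ℕ} → P 0 → All P r → ∀ j → P (r ‼ j)
‼-All p₀ []       _       = p₀
‼-All p₀ (p ∷ _)  zero    = p
‼-All p₀ (_ ∷ ps) (suc j) = ‼-All p₀ ps j

All-‼ : {P : ℕ → Set} (r : List ℕ) → (∀ j → P (r ‼ j)) → All P r
All-‼ []      _ = []
All-‼ (_ ∷ r) p = p 0 ∷ All-‼ r (p ∘ suc)

Sorted⇒‼ : ∀ {r} → Sorted r → ∀ j → r ‼ suc j ≤ r ‼ j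
Sorted⇒‼ []         _       = z≤n
Sorted⇒‼ (x≥ ∷ _)   zero    = ‼-All z≤n x≥ 0
Sorted⇒‼ (_ ∷ r↘)   (suc j) = Sorted⇒‼ r↘ j

‼⇒Sorted : ∀ r → (∀ j → r ‼ suc j ≤ r ‼ j) → Sorted r
‼⇒Sorted []      _  = []
‼⇒Sorted (x ∷ r) r↘ = All-‼ r below ∷ ‼⇒Sorted r (r↘ ∘ suc)
  where
  below : ∀ j → r ‼ j ≤ x
  below zero    = r↘ 0
  below (suc j) = ℕ.≤-trans (r↘ (suc j)) (below j)

-- For two consecutive rows r and s, descents r (s ‼_) lists the entries
-- at the descents of r.
descents : List ℕ → (ℕ → ℕ) → List ℕ
descents r h = map (r ‼_) (filter (λ j → h j <? r ‼ j) (upTo (length r)))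

descents-tail : ∀ x r h → map ((x ∷ r) ‼_) (filter (λ j → h j <? (x ∷ r) ‼ j) (applyUpTo suc (length r))) ≡
                descents r (h ∘ suc)
descents-tail x r h = begin
  map ((x ∷ r) ‼_) (filter P? (applyUpTo suc (length r)))
    ≡⟨ cong (map ((x ∷ r) ‼_) ∘ filter P?) (List.map-upTo suc (length r)) ⟨
  map ((x ∷ r) ‼_) (filter P? (map suc (upTo (length r))))
    ≡⟨ cong (map ((x ∷ r) ‼_)) (filter-map P? suc (upTo (length r))) ⟩
  map ((x ∷ r) ‼_) (map suc (filter (P? ∘ suc) (upTo (length r))))
    ≡⟨ List.map-∘ (filter (P? ∘ suc) (upTo (length r))) ⟨
  descents r (h ∘ suc) ∎
  where
  open ≡-Reasoning
  P? : ∀ j → Dec (h j < (x ∷ r) ‼ j)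
  P? j = h j <? (x ∷ r) ‼ j

descents-∷-yes : ∀ {x} r {h} → h 0 < x → descents (x ∷ r) h ≡ x ∷ descents r (h ∘ suc)
descents-∷-yes {x} r {h} h<x =
  trans (cong (map ((x ∷ r) ‼_)) (List.filter-accept (λ j → h j <? (x ∷ r) ‼ j) h<x)) (cong (x ∷_) (descents-tail x r h))

descents-∷-no : ∀ {x} r {h} → ¬ h 0 < x → descents (x ∷ r) h ≡ descents r (h ∘ suc)
descents-∷-no {x} r {h} h≮x =
  trans (cong (map ((x ∷ r) ‼_)) (List.filter-reject (λ j → h j <? (x ∷ r) ‼ j) h≮x)) (descents-tail x r h)

descents-All : {P : ℕ → Set} {r : List ℕ} (h : ℕ → ℕ) → All P r → All P (descents r h)
descents-All         h []                   = []
descents-All {P} {x ∷ r} h (p ∷ ps) = by-cases (h 0 <? x)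
  where
  by-cases : Dec (h 0 < x) → All P (descents (x ∷ r) h)
  by-cases (yes h<x) = subst (All P) (sym (descents-∷-yes r h<x)) (p ∷ descents-All (h ∘ suc) ps)
  by-cases (no  h≮x) = subst (All P) (sym (descents-∷-no r h≮x)) (descents-All (h ∘ suc) ps)

descents-Sorted : ∀ {r} (h : ℕ → ℕ) → Sorted r → Sorted (descents r h)
descents-Sorted         h []          = []
descents-Sorted {x ∷ r} h (x≥ ∷ r↘) = by-cases (h 0 <? x)
  where
  by-cases : Dec (h 0 < x) → Sorted (descents (x ∷ r) h)
  by-cases (yes h<x) = subst Sorted (sym (descents-∷-yes r h<x)) (descents-All (h ∘ suc) x≥ ∷ descents-Sorted (h ∘ suc) r↘)
  by-cases (no  h≮x) = subst Sorted (sym (descents-∷-no r h≮x)) (descents-Sorted (h ∘ suc) r↘)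

-- The row above s whose descents are u.
merge : List ℕ → List ℕ → List ℕ
merge []      u = u
-- Once `u` is used up, `u ‼ 0` is 0, the test fails, and the rest of `s` is copied.
merge (x ∷ s) u with x <? u ‼ 0
... | yes _ = u ‼ 0 ∷ merge s (List.drop 1 u)
... | no  _ = x ∷ merge s u

merge-All : {P : ℕ → Set} {s u : List ℕ} → All P s → All P u → All P (merge s u)
merge-All []       pu = pu
merge-All {u = u} (_∷_ {x} p ps) pu with x <? u ‼ 0
... | no _ = p ∷ merge-All ps pu
merge-All {u = y ∷ _} (_ ∷ ps) (q ∷ qs) | yes _ = q ∷ merge-All ps qs

-- Each emitted entry is the larger of the two current heads, hence bounds everything that is left
-- in both words.
merge-Sorted : ∀ {s u} → Sorted s → Sorted u → Sorted (merge s u)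
merge-Sorted []       u↘ = u↘
merge-Sorted {u = u} (_∷_ {x} x≥ s↘) u↘ with x <? u ‼ 0
merge-Sorted {u = y ∷ _} (x≥ ∷ s↘) (y≥ ∷ u↘) | yes x<y =
  merge-All (All.map (λ ≤x → ℕ.≤-trans ≤x (ℕ.<⇒≤ x<y)) x≥) y≥ ∷ merge-Sorted s↘ u↘
merge-Sorted {u = []} (x≥ ∷ s↘) [] | no _ = merge-All x≥ [] ∷ merge-Sorted s↘ []
merge-Sorted {u = y ∷ _} (x≥ ∷ s↘) (y≥ ∷ u↘) | no x≮y =
  merge-All x≥ (ℕ.≮⇒≥ x≮y ∷ All.map (λ ≤y → ℕ.≤-trans ≤y (ℕ.≮⇒≥ x≮y)) y≥) ∷ merge-Sorted s↘ (y≥ ∷ u↘)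

merge-above : ∀ s u j → s ‼ j ≤ merge s u ‼ j
merge-above []      u j = z≤n
merge-above (x ∷ s) u j with x <? u ‼ 0
merge-above (x ∷ s) u zero    | yes x< = ℕ.<⇒≤ x<
merge-above (x ∷ s) u (suc j) | yes _  = merge-above s (List.drop 1 u) j
merge-above (x ∷ s) u zero    | no _   = ℕ.≤-refl
merge-above (x ∷ s) u (suc j) | no _   = merge-above s u j

-- A letter of `u` is placed exactly where it exceeds the entry below; a copied entry makes no
-- descent. Past the end of `s` the entry below reads 0, and there positivity of `u` makes every
-- letter a descent.
descents-merge : ∀ s {u} → All (0 <_) u → descents (merge s u) (s ‼_) ≡ u
descents-merge []      []                     = refl
descents-merge []      (_∷_ {x} {u} 0<x 0<u)  = trans (descents-∷-yes u 0<x) (cong (x ∷_) (descents-merge [] 0<u))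
descents-merge (x ∷ s) {u} 0<u with x <? u ‼ 0
descents-merge (x ∷ s) {y ∷ u} (_ ∷ 0<u) | yes x<y =
  trans (descents-∷-yes (merge s u) x<y) (cong (y ∷_) (descents-merge s 0<u))
... | no _ = trans (descents-∷-no (merge s u) (ℕ.<-irrefl refl)) (descents-merge s 0<u)

merge-∷-< : ∀ {x y} s u → x < y → merge (x ∷ s) (y ∷ u) ≡ y ∷ merge s u
merge-∷-< {x} {y} s u x<y with x <? y
... | yes _  = refl
... | no x≮y = contradiction x<y x≮y

merge-∷-≥ : ∀ {x} s u → u ‼ 0 ≤ x → merge (x ∷ s) u ≡ x ∷ merge s u
merge-∷-≥ {x} s u u≤x with x <? u ‼ 0
... | yes x<u = contradiction u≤x (ℕ.<⇒≱ x<u)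
... | no _    = refl

merge-descents : ∀ s {r} → All (0 <_) s → All (0 <_) r → Sorted r → (∀ j → s ‼ j ≤ r ‼ j) →
                 merge s (descents r (s ‼_)) ≡ r
merge-descents []      0<s []          _        _ = refl
merge-descents []      0<s (_∷_ {y} {r} 0<y 0<r) (_ ∷ r↘) _ =
  trans (descents-∷-yes r 0<y) (cong (y ∷_) (merge-descents [] [] 0<r r↘ (λ _ → z≤n)))
-- The lower row cannot be the longer one: its positive entry would lie under a 0.
merge-descents (x ∷ s) (0<x ∷ _) [] _ s≤r = contradiction (s≤r 0) (ℕ.<⇒≱ 0<x)
merge-descents (x ∷ s) (_ ∷ 0<s) (_∷_ {y} {r} _ 0<r) (y≥ ∷ r↘) s≤r with ℕ.m≤n⇒m<n∨m≡n (s≤r 0)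
... | inj₁ x<y = begin
  merge (x ∷ s) (descents (y ∷ r) ((x ∷ s) ‼_)) ≡⟨ cong (merge (x ∷ s)) (descents-∷-yes r x<y) ⟩
  merge (x ∷ s) (y ∷ descents r (s ‼_))         ≡⟨ merge-∷-< s _ x<y ⟩
  y ∷ merge s (descents r (s ‼_))               ≡⟨ cong (y ∷_) (merge-descents s 0<s 0<r r↘ (s≤r ∘ suc)) ⟩
  y ∷ r                                         ∎
  where open ≡-Reasoning
... | inj₂ refl = begin
  merge (x ∷ s) (descents (x ∷ r) ((x ∷ s) ‼_)) ≡⟨ cong (merge (x ∷ s)) (descents-∷-no r (ℕ.<-irrefl refl)) ⟩
  -- The remaining letters come from later entries of the row, all at most `x`, so the merge copies
  -- `x`.
  merge (x ∷ s) (descents r (s ‼_))             ≡⟨ merge-∷-≥ s _ (‼-All z≤n (descents-All (s ‼_) y≥) 0) ⟩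
  x ∷ merge s (descents r (s ‼_))               ≡⟨ cong (x ∷_) (merge-descents s 0<s 0<r r↘ (s≤r ∘ suc)) ⟩
  x ∷ r                                         ∎
  where open ≡-Reasoning

-- Weakly decreasing words as multisets of letters

-- The vector entry at index `j` is the multiplicity of the letter `j + 1`; the shift reserves 0 for
-- positions outside a row.
toWord : ∀ {m} → Vec ℕ m → List ℕ
toWord []       = []
toWord (k ∷ ks) = map suc (toWord ks) List.++ List.replicate k 1

toWord-positive : ∀ {m} (ks : Vec ℕ m) → All (0 <_) (toWord ks)
toWord-positive []       = []
toWord-positive (k ∷ ks) = All.++⁺ (All.map⁺ (All.map (λ _ → s≤s z≤n) (toWord-positive ks))) (All.replicate⁺ k (s≤s z≤n))

toWord-bounded : ∀ {m} (ks : Vec ℕ m) → All (_≤ m) (toWord ks)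
toWord-bounded []       = []
toWord-bounded (k ∷ ks) = All.++⁺ (All.map⁺ (All.map s≤s (toWord-bounded ks))) (All.replicate⁺ k (s≤s z≤n))

toWord-Sorted : ∀ {m} (ks : Vec ℕ m) → Sorted (toWord ks)
toWord-Sorted []       = []
toWord-Sorted (k ∷ ks) = AllPairs.++⁺
  (AllPairs.map⁺ (mapPairs (toWord-Sorted ks)))
  (ones k)
  (All.map⁺ (All.map (λ _ → All.replicate⁺ k (s≤s z≤n)) (toWord-positive ks)))
  where
  mapPairs : ∀ {u} → Sorted u → AllPairs (λ x y → suc x ≥ suc y) u
  mapPairs []         = []
  mapPairs (x≥ ∷ u↘) = All.map s≤s x≥ ∷ mapPairs u↘
  ones : ∀ k → Sorted (List.replicate k 1)
  ones zero    = []
  ones (suc k) = All.replicate⁺ k ℕ.≤-refl ∷ ones k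

length-toWord : ∀ {m} (ks : Vec ℕ m) → length (toWord ks) ≡ sum (lookup ks)
length-toWord []       = refl
length-toWord (k ∷ ks) = begin
  length (map suc (toWord ks) List.++ List.replicate k 1)
    ≡⟨ List.length-++ (map suc (toWord ks)) ⟩
  length (map suc (toWord ks)) ℕ.+ length (List.replicate k 1)
    ≡⟨ cong₂ ℕ._+_ (trans (List.length-map suc (toWord ks)) (length-toWord ks)) (List.length-replicate k) ⟩
  sum (lookup ks) ℕ.+ k
    ≡⟨ ℕ.+-comm _ k ⟩
  k ℕ.+ sum (lookup ks) ∎
  where open ≡-Reasoning

count-++ : ∀ v us ws → count v (us List.++ ws) ≡ count v us ℕ.+ count v ws
count-++ v us ws = trans (cong length (List.filter-++ (ℕ._≟ v) us ws)) (List.length-++ (filter (ℕ._≟ v) us))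

count-map-suc : ∀ v u → count (suc v) (map suc u) ≡ count v u
count-map-suc v []      = refl
-- Both filters inspect only this boolean, because `suc x ≡ᵇ suc v` reduces to `x ≡ᵇ v`.
count-map-suc v (x ∷ u) with x ℕ.≡ᵇ v
... | true  = cong suc (count-map-suc v u)
... | false = count-map-suc v u

count-toWord : ∀ {m} (ks : Vec ℕ m) j → count (suc (toℕ j)) (toWord ks) ≡ lookup ks j
count-toWord (k ∷ ks) j = trans (count-++ (suc (toℕ j)) (map suc (toWord ks)) _) (split j)
  where
  split : ∀ j → count (suc (toℕ j)) (map suc (toWord ks)) ℕ.+ count (suc (toℕ j)) (List.replicate k 1) ≡ lookup (k ∷ ks) j
  split zero = cong₂ ℕ._+_
    (trans (count-map-suc 0 (toWord ks)) (cong length (List.filter-none (ℕ._≟ 0) (All.map ℕ.>⇒≢ (toWord-positive ks)))))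
    (trans (cong length (List.filter-all (ℕ._≟ 1) (All.replicate⁺ k refl))) (List.length-replicate k))
  split (suc j) = trans (cong₂ ℕ._+_
    (trans (count-map-suc (suc (toℕ j)) (toWord ks)) (count-toWord ks j))
    (cong length (List.filter-none (ℕ._≟ suc (suc (toℕ j))) (All.replicate⁺ k (λ ())))))
    (ℕ.+-identityʳ _)

-- Raising the multiplicity of a letter that is at least as large as all others prepends it; this
-- builds any decreasing word from its tail in `toWord-surjective`.
toWord-insert : ∀ {m} (ks : Vec ℕ m) y → All (_≤ suc (toℕ y)) (toWord ks) →
                toWord (ks [ y ]%= suc) ≡ suc (toℕ y) ∷ toWord ks
-- The letters of `toWord ks` are positive before the shift and hence at least 2 after it, so the
-- bound 1 leaves none.
toWord-insert (k ∷ ks) zero ≤1 with toWord ks | toWord-positive ks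
... | []    | _         = refl
... | x ∷ _ | 0<x ∷ _ = contradiction (s≤s⁻¹ (All.head ≤1)) (ℕ.<⇒≱ 0<x)
toWord-insert (k ∷ ks) (suc y) ≤y = cong (λ u → map suc u List.++ List.replicate k 1)
  (toWord-insert ks y (All.map s≤s⁻¹ (All.map⁻ (All.++⁻ˡ (map suc (toWord ks)) ≤y))))

toWord-zero : ∀ m → toWord (replicate m 0) ≡ []
toWord-zero zero    = refl
toWord-zero (suc m) = cong (λ u → map suc u List.++ []) (toWord-zero m)

toWord-surjective : ∀ {m u} → Sorted u → All (0 <_) u → All (_≤ m) u → ∃[ ks ] toWord {m} ks ≡ u
toWord-surjective {m} [] _ _ = replicate m 0 , toWord-zero m
toWord-surjective {m} {suc y ∷ u} (y≥ ∷ u↘) (_ ∷ 0<u) (y<m ∷ u≤m) with toWord-surjective u↘ 0<u u≤m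
... | ks , refl = ks [ fromℕ< y<m ]%= suc ,
  trans (toWord-insert ks (fromℕ< y<m) (subst (λ t → All (_≤ suc t) (toWord ks)) (sym (Fin.toℕ-fromℕ< y<m)) y≥))
        (cong (λ t → suc t ∷ toWord ks) (Fin.toℕ-fromℕ< y<m))

lookup-extensional : {A : Set} {n : ℕ} {u v : Vec A n} → lookup u ≗ lookup v → u ≡ v
lookup-extensional {u = u} {v} eq =
  trans (sym (Vec.tabulate∘lookup u)) (trans (Vec.tabulate-cong eq) (Vec.tabulate∘lookup v))

toWord-injective : ∀ {m} {ks ls : Vec ℕ m} → toWord ks ≡ toWord ls → ks ≡ ls
toWord-injective {ks = ks} {ls} eq = lookup-extensional λ j →
  trans (sym (count-toWord ks j)) (trans (cong (count (suc (toℕ j))) eq) (count-toWord ls j))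

-- Plane partitions and matrices

rowDescents : Array → ℕ → List ℕ
rowDescents π i = descents (row π i) (entry π (suc i))

IsPlanePartition-∷ : ∀ {r π} → 0 < length r → All (0 <_) r → Sorted r → (∀ j → row π 0 ‼ j ≤ r ‼ j) →
                     IsPlanePartition π → IsPlanePartition (r ∷ π)
IsPlanePartition-∷ 0<len 0<r r↘ π≤r (isPlanePartition 0<π 0<lens down right) = isPlanePartition
  (0<r ∷ 0<π) (0<len ∷ 0<lens)
  (λ { zero → π≤r ; (suc i) → down i })
  (λ { zero → Sorted⇒‼ r↘ ; (suc i) → right i })

IsPlanePartition-[] : IsPlanePartition []
IsPlanePartition-[] = isPlanePartition [] [] (λ _ _ → z≤n) (λ _ _ → z≤n)

IsPlanePartition-tail : ∀ {r π} → IsPlanePartition (r ∷ π) → IsPlanePartition π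
IsPlanePartition-tail (isPlanePartition (_ ∷ 0<π) (_ ∷ 0<lens) down right) =
  isPlanePartition 0<π 0<lens (down ∘ suc) (right ∘ suc)

row-positive : ∀ {π} → IsPlanePartition π → ∀ i → All (0 <_) (row π i)
row-positive {π} pp = go π (IsPlanePartition.entries-positive pp)
  where
  go : ∀ π → All (All (0 <_)) π → ∀ i → All (0 <_) (row π i)
  go []      []         _       = []
  go (_ ∷ _) (0<r ∷ _)  zero    = 0<r
  go (_ ∷ π) (_ ∷ 0<π)  (suc i) = go π 0<π i

row-Sorted : ∀ {π} → IsPlanePartition π → ∀ i → Sorted (row π i)
row-Sorted {π} pp i = ‼⇒Sorted (row π i) (IsPlanePartition.right pp i)

row₀-[] : ∀ {π} → IsPlanePartition π → (∀ j → row π 0 ‼ j ≤ 0) → π ≡ []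
row₀-[] {[]} _ _ = refl
row₀-[] {[] ∷ _} pp _ with () ← All.head (IsPlanePartition.rows-nonempty pp)
row₀-[] {(x ∷ _) ∷ _} pp ≤0 = contradiction (≤0 0) (ℕ.<⇒≱ (All.head (All.head (IsPlanePartition.entries-positive pp))))

-- A zero row has only zero rows below it, and neither is listed.
infixr 5 _∷′_
_∷′_ : List ℕ → Array → Array
[]      ∷′ π = []
(x ∷ r) ∷′ π = (x ∷ r) ∷ π

row₀-∷′ : ∀ r π → row (r ∷′ π) 0 ≡ r
row₀-∷′ []      π = refl
row₀-∷′ (_ ∷ _) π = refl

row-suc-∷′ : ∀ {r π} → IsPlanePartition π → (∀ j → row π 0 ‼ j ≤ r ‼ j) → ∀ i → row (r ∷′ π) (suc i) ≡ row π i
row-suc-∷′ {[]}    pp π≤r i = sym (cong (λ π → row π i) (row₀-[] pp π≤r))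
row-suc-∷′ {_ ∷ _} _  _   _ = refl

PP-∷′ : ∀ {n m r π} → All (0 <_) r → Sorted r → (∀ j → row π 0 ‼ j ≤ r ‼ j) → All (_≤ m) r →
        PP n m π → PP (suc n) m (r ∷′ π)
PP-∷′ {r = []}    _   _   _   _   _                = IsPlanePartition-[] , z≤n , λ _ _ → z≤n
PP-∷′ {r = _ ∷ _} 0<r r↘ π≤r r≤m (pp , len , ≤m) =
  IsPlanePartition-∷ (s≤s z≤n) 0<r r↘ π≤r pp , s≤s len , λ { zero → ‼-All z≤n r≤m ; (suc i) → ≤m i }

fromMatrix : ∀ {n m} → Vec (Vec ℕ m) n → Array
fromMatrix []       = []
fromMatrix (ks ∷ D) = merge (row (fromMatrix D) 0) (toWord ks) ∷′ fromMatrix D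

fromMatrix-PP : ∀ {n m} (D : Vec (Vec ℕ m) n) → PP n m (fromMatrix D)
fromMatrix-PP []       = IsPlanePartition-[] , z≤n , λ _ _ → z≤n
fromMatrix-PP (ks ∷ D) = let (pp , _ , ≤m) = fromMatrix-PP D in PP-∷′
  (merge-All (row-positive pp 0) (toWord-positive ks))
  (merge-Sorted (row-Sorted pp 0) (toWord-Sorted ks))
  (merge-above (row (fromMatrix D) 0) (toWord ks))
  (merge-All (All-‼ (row (fromMatrix D) 0) (≤m 0)) (toWord-bounded ks))
  (fromMatrix-PP D)

-- Makes the matrix recoverable from the array, which gives injectivity, and reduces the statistics
-- `d` and `c` to row and column sums.
rowDescents-fromMatrix : ∀ {n m} (D : Vec (Vec ℕ m) n) i → rowDescents (fromMatrix D) (toℕ i) ≡ toWord (lookup D i)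
rowDescents-fromMatrix (ks ∷ D) i = by-row i
  where
  s = row (fromMatrix D) 0
  above : ∀ i → row (fromMatrix (ks ∷ D)) (suc i) ≡ row (fromMatrix D) i
  above = row-suc-∷′ {merge s (toWord ks)} (proj₁ (fromMatrix-PP D)) (merge-above s (toWord ks))
  by-row : ∀ i → rowDescents (fromMatrix (ks ∷ D)) (toℕ i) ≡ toWord (lookup (ks ∷ D) i)
  by-row zero = trans
    (cong₂ (λ r s → descents r (s ‼_)) (row₀-∷′ (merge s (toWord ks)) (fromMatrix D)) (above 0))
    (descents-merge s (toWord-positive ks))
  by-row (suc i) = trans
    (cong₂ (λ r s → descents r (s ‼_)) (above (toℕ i)) (above (suc (toℕ i))))
    (rowDescents-fromMatrix D i)

fromMatrix-injective : ∀ {n m} {D D′ : Vec (Vec ℕ m) n} → fromMatrix D ≡ fromMatrix D′ → D ≡ D′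
fromMatrix-injective {D = D} {D′} eq = lookup-extensional λ i → toWord-injective
  (trans (sym (rowDescents-fromMatrix D i)) (trans (cong (λ π → rowDescents π (toℕ i)) eq) (rowDescents-fromMatrix D′ i)))

fromMatrix-surjective : ∀ {n m π} → PP n m π → ∃[ D ] fromMatrix {n} {m} D ≡ π
fromMatrix-surjective {zero}  {π = []} _ = [] , refl
fromMatrix-surjective {suc n} {m} {π} (pp , len , ≤m) = (proj₁ top ∷ proj₁ rest) , (begin
  merge (row (fromMatrix (proj₁ rest)) 0) (toWord (proj₁ top)) ∷′ fromMatrix (proj₁ rest)
    ≡⟨ cong₂ (λ π u → merge (row π 0) u ∷′ π) (proj₂ rest) (proj₂ top) ⟩
  merge (row π′ 0) (rowDescents π 0) ∷′ π′
    ≡⟨ cong (λ s → merge (row π′ 0) (descents (row π 0) (s ‼_)) ∷′ π′) (row-drop π 0) ⟨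
  merge (row π′ 0) (descents (row π 0) (row π′ 0 ‼_)) ∷′ π′
    ≡⟨ cong (_∷′ π′) (merge-descents (row π′ 0) (row-positive pp′ 0) (row-positive pp 0) (row-Sorted pp 0)
         (λ j → subst (λ s → s ‼ j ≤ row π 0 ‼ j) (sym (row-drop π 0)) (IsPlanePartition.down pp 0 j))) ⟩
  row π 0 ∷′ π′
    ≡⟨ ∷′-drop pp ⟩
  π ∎)
  where
  open ≡-Reasoning
  -- The matrix has a top row even when `π` is empty; `drop` treats the empty array and a nonempty
  -- one alike.
  π′ = List.drop 1 π
  row-drop : ∀ π i → row (List.drop 1 π) i ≡ row π (suc i)
  row-drop []      _ = refl
  row-drop (_ ∷ _) _ = refl
  drop-PP : ∀ π → IsPlanePartition π → length π ≤ suc n → EntriesAtMost m π → PP n m (List.drop 1 π)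
  drop-PP []      pp _   ≤m = pp , z≤n , ≤m
  drop-PP (_ ∷ _) pp len ≤m = IsPlanePartition-tail pp , s≤s⁻¹ len , ≤m ∘ suc
  ∷′-drop : ∀ {π} → IsPlanePartition π → row π 0 ∷′ List.drop 1 π ≡ π
  ∷′-drop {[]}          _  = refl
  ∷′-drop {(_ ∷ _) ∷ _} _  = refl
  ∷′-drop {[] ∷ _}      pp with () ← All.head (IsPlanePartition.rows-nonempty pp)
  π′-PP = drop-PP π pp len ≤m
  pp′ = proj₁ π′-PP
  rest = fromMatrix-surjective π′-PP
  top = toWord-surjective (descents-Sorted (entry π 1) (row-Sorted pp 0))
    (descents-All (entry π 1) (row-positive pp 0)) (descents-All (entry π 1) (All-‼ (row π 0) (≤m 0)))

-- Statistics of plane partitions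

length-filter-⊎ : {A : Set} {P Q R : A → Set} (P? : Decidable P) (Q? : Decidable Q) (R? : Decidable R) →
                  (∀ {x} → P x → Q x ⊎ R x) → (∀ {x} → Q x → P x) → (∀ {x} → R x → P x) → (∀ {x} → Q x → ¬ R x) →
                  ∀ xs → length (filter P? xs) ≡ length (filter Q? xs) ℕ.+ length (filter R? xs)
length-filter-⊎ P? Q? R? P⇒ Q⇒ R⇒ Q#R []       = refl
length-filter-⊎ P? Q? R? P⇒ Q⇒ R⇒ Q#R (x ∷ xs) with P? x | Q? x | R? x | length-filter-⊎ P? Q? R? P⇒ Q⇒ R⇒ Q#R xs
... | yes _ | yes _ | no  _ | eq = cong suc eq
... | yes _ | no  _ | yes _ | eq = trans (cong suc eq) (sym (ℕ.+-suc _ _))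
... | no  _ | no  _ | no  _ | eq = eq
... | yes p | no ¬q | no ¬r | _ with P⇒ p
...   | inj₁ q = contradiction q ¬q
...   | inj₂ r = contradiction r ¬r
length-filter-⊎ P? Q? R? P⇒ Q⇒ R⇒ Q#R (x ∷ xs) | no ¬p | yes q | _     | _ = contradiction (Q⇒ q) ¬p
length-filter-⊎ P? Q? R? P⇒ Q⇒ R⇒ Q#R (x ∷ xs) | no ¬p | no _  | yes r | _ = contradiction (R⇒ r) ¬p
length-filter-⊎ P? Q? R? P⇒ Q⇒ R⇒ Q#R (x ∷ xs) | yes _ | yes q | yes r | _ = contradiction r (Q#R q)

-- Needed because `c` of an array without its top row ranges over its own first row, which may be
-- shorter than the one removed.
length-filter-upTo : {R : ℕ → Set} (R? : Decidable R) {k l : ℕ} → k ≤ l → (∀ {j} → R j → j < k) →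
                     length (filter R? (upTo l)) ≡ length (filter R? (upTo k))
length-filter-upTo {R} R? {k} k≤l R⇒< = go (ℕ.≤⇒≤′ k≤l)
  where
  open ≡-Reasoning
  go : ∀ {l} → k ℕ.≤′ l → length (filter R? (upTo l)) ≡ length (filter R? (upTo k))
  go (ℕ.≤′-reflexive refl) = refl
  go {suc l} (ℕ.≤′-step k≤′l) = begin
    length (filter R? (upTo (suc l)))                             ≡⟨ cong (length ∘ filter R?) (List.upTo-∷ʳ l) ⟨
    length (filter R? (upTo l List.++ l ∷ []))                    ≡⟨ cong length (List.filter-++ R? (upTo l) (l ∷ [])) ⟩
    length (filter R? (upTo l) List.++ filter R? (l ∷ []))        ≡⟨ cong (λ ys → length (filter R? (upTo l) List.++ ys))
                                                                     (List.filter-reject R? {xs = []} (ℕ.≤⇒≯ (ℕ.≤′⇒≤ k≤′l) ∘ R⇒<)) ⟩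
    length (filter R? (upTo l) List.++ [])                        ≡⟨ cong length (List.++-identityʳ (filter R? (upTo l))) ⟩
    length (filter R? (upTo l))                                   ≡⟨ go k≤′l ⟩
    length (filter R? (upTo k))                                   ∎

length-filter-map-filter : {A B : Set} {P : A → Set} {Q : B → Set} (P? : Decidable P) (Q? : Decidable Q)
                           (f : A → B) (xs : List A) →
  length (filter (λ x → P? x ×-dec Q? (f x)) xs) ≡ length (filter Q? (map f (filter P? xs)))
length-filter-map-filter P? Q? f []       = refl
length-filter-map-filter P? Q? f (x ∷ xs) with P? x
... | no  _ = length-filter-map-filter P? Q? f xs
... | yes _ with Q? (f x)
...   | yes _ = cong suc (length-filter-map-filter P? Q? f xs)
...   | no  _ = length-filter-map-filter P? Q? f xs

d-descents : ∀ π i → d π i ≡ length (rowDescents π i)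
d-descents π i = sym (List.length-map (row π i ‼_)
  (filter (λ j → entry π (suc i) j <? entry π i j) (upTo (length (row π i)))))

column-∷ : ∀ r π j → column (r ∷ π) j ≡ r ‼ j ∷ column π j
column-∷ r π j = cong (r ‼ j ∷_)
  (trans (List.map-applyUpTo suc (λ i → entry (r ∷ π) i j) (length π)) (sym (List.map-upTo (λ i → entry π i j) (length π))))

entry≤entry₀ : ∀ {π} → IsPlanePartition π → ∀ i j → entry π i j ≤ entry π 0 j
entry≤entry₀ pp zero    j = ℕ.≤-refl
entry≤entry₀ pp (suc i) j = ℕ.≤-trans (IsPlanePartition.down pp i j) (entry≤entry₀ pp i j)

∈-column : ∀ {π v} → IsPlanePartition π → ∀ j → v ∈ column π j → v ≤ entry π 0 j
∈-column pp j v∈ with i , _ , refl ← ∈-map⁻ _ v∈ = entry≤entry₀ pp i j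

‼-positive⇒< : ∀ r {j} → 0 < r ‼ j → j < length r
‼-positive⇒< (_ ∷ _) {zero}  _   = s≤s z≤n
‼-positive⇒< (_ ∷ r) {suc j} 0<  = s≤s (‼-positive⇒< r 0<)

<⇒‼-positive : ∀ {r j} → All (0 <_) r → j < length r → 0 < r ‼ j
<⇒‼-positive {j = zero}  (0<x ∷ _) _         = 0<x
<⇒‼-positive {j = suc j} (_ ∷ 0<r) (s≤s j<r) = <⇒‼-positive 0<r j<r

-- Otherwise a positive entry of the lower row would sit just past the end of `r`, under a 0.
length-row₀≤ : ∀ {r π} → IsPlanePartition (r ∷ π) → length (row π 0) ≤ length r
length-row₀≤ {r} {π} pp = ℕ.≮⇒≥ λ r<π → ℕ.<⇒≱
  (<⇒‼-positive (row-positive pp 1) r<π)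
  (ℕ.≤-trans (IsPlanePartition.down pp 0 (length r)) (ℕ.≤-reflexive (‼-≥ r ℕ.≤-refl)))

-- A column containing v has exactly one descent with entry v, its lowest
-- entry v.
c-descents : ∀ {n π} → IsPlanePartition π → length π ≤ n → ∀ v →
             c π (suc v) ≡ sum {n} (λ i → count (suc v) (rowDescents π (toℕ i)))
c-descents {n} {[]}    _  _        v = sym (sum-replicate-zero n)
c-descents {suc n} {r ∷ π} pp (s≤s len) v = begin
  length (filter P? (upTo (length r)))
    -- The value occurs in a column either as a descent of the top row (`Q?`) or in the rows below
    -- (`R?`). Both at once is impossible, since a descent exceeds everything beneath it.
    ≡⟨ length-filter-⊎ P? Q? R? P⇒ Q⇒ R⇒ Q#R (upTo (length r)) ⟩
  length (filter Q? (upTo (length r))) ℕ.+ length (filter R? (upTo (length r)))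
    ≡⟨ cong₂ ℕ._+_ (length-filter-map-filter (λ j → entry π 0 j <? r ‼ j) (ℕ._≟ suc v) (r ‼_) (upTo (length r)))
                   (length-filter-upTo R? (length-row₀≤ pp) R⇒<) ⟩
  count (suc v) (rowDescents (r ∷ π) 0) ℕ.+ c π (suc v)
    ≡⟨ cong (ℕ._+_ (count (suc v) (rowDescents (r ∷ π) 0))) (c-descents tail-pp len v) ⟩
  count (suc v) (rowDescents (r ∷ π) 0) ℕ.+ sum {n} (λ i → count (suc v) (rowDescents π (toℕ i))) ∎
  where
  open ≡-Reasoning
  tail-pp = IsPlanePartition-tail pp
  P? = λ j → suc v ∈? column (r ∷ π) j
  Q? = λ j → (entry π 0 j <? r ‼ j) ×-dec (r ‼ j ℕ.≟ suc v)
  R? = λ j → suc v ∈? column π j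
  Q#R : ∀ {j} → entry π 0 j < r ‼ j × r ‼ j ≡ suc v → ¬ suc v ∈ column π j
  Q#R {j} (lt , eq) v∈ = ℕ.<⇒≱ lt (ℕ.≤-trans (ℕ.≤-reflexive eq) (∈-column tail-pp j v∈))
  Q⇒ : ∀ {j} → entry π 0 j < r ‼ j × r ‼ j ≡ suc v → suc v ∈ column (r ∷ π) j
  Q⇒ {j} (_ , eq) = subst (suc v ∈_) (sym (column-∷ r π j)) (here (sym eq))
  R⇒ : ∀ {j} → suc v ∈ column π j → suc v ∈ column (r ∷ π) j
  R⇒ {j} v∈ = subst (suc v ∈_) (sym (column-∷ r π j)) (there v∈)
  R⇒< : ∀ {j} → suc v ∈ column π j → j < length (row π 0)
  R⇒< {j} v∈ = ‼-positive⇒< (row π 0) (ℕ.≤-trans (s≤s z≤n) (∈-column tail-pp j v∈))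
  first∈ : ∀ π {j} → 0 < entry π 0 j → entry π 0 j ∈ column π j
  first∈ (_ ∷ _) _ = here refl
  P⇒ : ∀ {j} → suc v ∈ column (r ∷ π) j → (entry π 0 j < r ‼ j × r ‼ j ≡ suc v) ⊎ suc v ∈ column π j
  P⇒ {j} v∈ with subst (suc v ∈_) (column-∷ r π j) v∈
  ... | there v∈π = inj₂ v∈π
  ... | here eq with ℕ.m≤n⇒m<n∨m≡n (IsPlanePartition.down pp 0 j)
  ...   | inj₁ lt   = inj₁ (lt , sym eq)
  -- Without a descent the value is repeated directly below; as it is positive, `π` has a first row
  -- and the column of `π` contains it.
  ...   | inj₂ same = inj₂ (subst (_∈ column π j) (trans same (sym eq))
                        (first∈ π (subst (0 <_) (trans eq (sym same)) (s≤s z≤n))))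

a-rows : ∀ {n} π → length π ≤ n → ∀ v → a π v ≡ sum {n} (λ i → count v (row π (toℕ i)))
a-rows {n}     []      _         v = sym (sum-replicate-zero n)
a-rows {suc n} (r ∷ π) (s≤s len) v = trans (count-++ v r (concat π)) (cong (ℕ._+_ (count v r)) (a-rows π len v))

size-rows : ∀ {n} π → length π ≤ n → ℕ.sum (shape π) ≡ sum {n} (λ i → length (row π (toℕ i)))
size-rows {n}     []      _         = sym (sum-replicate-zero n)
size-rows {suc n} (r ∷ π) (s≤s len) = cong (ℕ._+_ (length r)) (size-rows π len)

map-‼-upTo : ∀ r → map (r ‼_) (upTo (length r)) ≡ r
map-‼-upTo []      = refl
map-‼-upTo (x ∷ r) = cong (x ∷_) (trans (List.map-applyUpTo suc ((x ∷ r) ‼_) (length r))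
  (trans (sym (List.map-upTo (r ‼_) (length r))) (map-‼-upTo r)))

rowDescents-strict : ∀ π → ColumnStrict π → ∀ i → rowDescents π i ≡ row π i
rowDescents-strict π strict i = trans
  (cong (map (row π i ‼_)) (List.filter-all (λ j → entry π (suc i) j <? entry π i j)
    (All.tabulate (λ {j} j∈ → strict i j (subst (j <_) (sym (‼-map-length π i)) (∈-upTo⁻ j∈))))))
  (map-‼-upTo (row π i))

-- A filter that preserves the length discards nothing, so every cell of every row passes the
-- descent test.
full⇒strict : ∀ π → (∀ i → d π i ≡ length (row π i)) → ColumnStrict π
full⇒strict π full i j j<
  = proj₂ (∈-filter⁻ P? {xs = upTo (length (row π i))} (subst (j ∈_)
      (sym (List.filter-complete P? (trans (full i) (sym (List.length-upTo (length (row π i)))))))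
      (∈-upTo⁺ (subst (j <_) (‼-map-length π i) j<))))
  where
  P? = λ j → entry π (suc i) j <? entry π i j

d≤length : ∀ π i → d π i ≤ length (row π i)
d≤length π i = ℕ.≤-trans (List.length-filter _ (upTo (length (row π i)))) (ℕ.≤-reflexive (List.length-upTo _))

-- Finite sums of natural numbers

sum-mono-≤ : ∀ {n} {f h : Fin n → ℕ} → (∀ i → f i ≤ h i) → sum f ≤ sum h
sum-mono-≤ {zero}  _   = z≤n
sum-mono-≤ {suc n} f≤h = ℕ.+-mono-≤ (f≤h zero) (sum-mono-≤ (f≤h ∘ suc))

-- Equality case of a termwise bound; it turns a maximal number of descents into full rows.
sum-tight : ∀ {n} {f h : Fin n → ℕ} → (∀ i → f i ≤ h i) → sum h ≤ sum f → ∀ i → f i ≡ h i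
sum-tight {suc n} {f} {h} f≤h h≤f zero    = ℕ.≤-antisym (f≤h zero)
  (ℕ.+-cancelʳ-≤ (sum (h ∘ suc)) _ _ (ℕ.≤-trans h≤f (ℕ.+-monoʳ-≤ (f zero) (sum-mono-≤ (f≤h ∘ suc)))))
sum-tight {suc n} {f} {h} f≤h h≤f (suc i) = sum-tight (f≤h ∘ suc)
  (ℕ.+-cancelˡ-≤ (f zero) _ _ (ℕ.≤-trans (ℕ.+-monoˡ-≤ (sum (h ∘ suc)) (f≤h zero)) h≤f)) i

sum-δ : ∀ {m} (y : Fin m) (V : Fin m → ℕ) → sum (λ v → δ y v ℕ.* V v) ≡ V y
sum-δ {suc m} zero V = begin
  1 ℕ.* V zero ℕ.+ sum (λ v → δ zero (suc v) ℕ.* V (suc v))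
    ≡⟨ cong₂ ℕ._+_ (ℕ.*-identityˡ (V zero)) (sum-cong-≗ (λ v → cong (ℕ._* V (suc v)) (Vec.lookup-replicate v 0))) ⟩
  V zero ℕ.+ sum {m} (λ _ → 0)  ≡⟨ cong (ℕ._+_ (V zero)) (sum-replicate-zero m) ⟩
  V zero ℕ.+ 0                  ≡⟨ ℕ.+-identityʳ _ ⟩
  V zero                        ∎
  where open ≡-Reasoning
sum-δ {suc m} (suc y) V = sum-δ y (V ∘ suc)

-- Exponent counterpart of `_at_`: the default 0 there matches the default `1#`.
extend : ∀ {n} → (Fin n → ℕ) → ℕ → ℕ
extend {n} U i with i <? n
... | yes i<n = U (fromℕ< i<n)
... | no  _   = 0

extend-toℕ : ∀ {n} (U : Fin n → ℕ) i → extend U (toℕ i) ≡ U i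
extend-toℕ {n} U i with toℕ i <? n
... | yes i<n = cong U (Fin.fromℕ<-toℕ i i<n)
... | no  i≮n = contradiction (Fin.toℕ<n i) i≮n

at-mon : ∀ {n k} {x : Fin n → Series k} {u : Fin n → Fin k → ℕ} → (∀ i → x i ≈ mon (u i)) →
         ∀ j → (x at j) ≈ mon (λ t → extend (λ i → u i t) j)
at-mon {n} x≈ j with j <? n
... | yes j<n = x≈ (fromℕ< j<n)
... | no  _   = 1-mon

count-∷-δ : ∀ {m} (y v : Fin m) u → count (suc (toℕ v)) (suc (toℕ y) ∷ u) ≡ δ y v ℕ.+ count (suc (toℕ v)) u
count-∷-δ y v u = by-cases (y Fin.≟ v)
  where
  by-cases : Dec (y ≡ v) → _
  by-cases (yes refl) = trans (cong length (List.filter-accept (ℕ._≟ suc (toℕ y)) {xs = u} refl))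
    (cong (λ t → t ℕ.+ count (suc (toℕ y)) u) (sym (δ-same y)))
  by-cases (no y≢v) = trans (cong length (List.filter-reject (ℕ._≟ suc (toℕ v)) {xs = u} (y≢v ∘ Fin.toℕ-injective ∘ ℕ.suc-injective)))
    (cong (λ t → t ℕ.+ count (suc (toℕ v)) u) (sym (δ-other (y≢v ∘ sym))))

-- Regroups a word by letters. Letters start at 1 while `V` is indexed from 0, hence `pred`; the
-- bounds on `u` keep every index inside the range of `V`.
sum-letters : ∀ {m} (V : Fin m → ℕ) {u} → All (0 <_) u → All (_≤ m) u →
              ℕ.sum (map (extend V ∘ pred) u) ≡ sum (λ v → count (suc (toℕ v)) u ℕ.* V v)
sum-letters {m} V [] [] = sym (sum-replicate-zero m)
sum-letters {m} V {suc y ∷ u} (_ ∷ 0<u) (y<m ∷ u≤m) = begin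
  extend V y ℕ.+ ℕ.sum (map (extend V ∘ pred) u)
    ≡⟨ cong₂ ℕ._+_ (trans (cong (extend V) (sym y≡)) (extend-toℕ V y′)) (sum-letters V 0<u u≤m) ⟩
  V y′ ℕ.+ sum (λ v → count (suc (toℕ v)) u ℕ.* V v)
    ≡⟨ cong (λ t → t ℕ.+ sum (λ v → count (suc (toℕ v)) u ℕ.* V v)) (sum-δ y′ V) ⟨
  sum (λ v → δ y′ v ℕ.* V v) ℕ.+ sum (λ v → count (suc (toℕ v)) u ℕ.* V v)
    ≡⟨ ∑-distrib-+ (λ v → δ y′ v ℕ.* V v) (λ v → count (suc (toℕ v)) u ℕ.* V v) ⟨
  sum (λ v → δ y′ v ℕ.* V v ℕ.+ count (suc (toℕ v)) u ℕ.* V v)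
    ≡⟨ sum-cong-≗ (λ v → trans (sym (ℕ.*-distribʳ-+ (V v) (δ y′ v) (count (suc (toℕ v)) u)))
         (cong (ℕ._* V v) (trans (sym (count-∷-δ y′ v u)) (cong (λ t → count (suc (toℕ v)) (suc t ∷ u)) y≡)))) ⟩
  sum (λ v → count (suc (toℕ v)) (suc y ∷ u) ℕ.* V v) ∎
  where
  open ≡-Reasoning
  y′ = fromℕ< y<m
  y≡ : toℕ y′ ≡ y
  y≡ = Fin.toℕ-fromℕ< y<m

-- Sums over the descent cells

sum-filter-concatMap : {A B : Set} {P : B → Set} (P? : Decidable P) (F : B → ℕ) (f : A → List B) (xs : List A) →
  ℕ.sum (map F (filter P? (concatMap f xs))) ≡ ℕ.sum (map (λ x → ℕ.sum (map F (filter P? (f x)))) xs)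
sum-filter-concatMap P? F f []       = refl
sum-filter-concatMap P? F f (x ∷ xs) = begin
  ℕ.sum (map F (filter P? (f x List.++ concatMap f xs)))
    ≡⟨ cong (ℕ.sum ∘ map F) (List.filter-++ P? (f x) _) ⟩
  ℕ.sum (map F (filter P? (f x) List.++ filter P? (concatMap f xs)))
    ≡⟨ cong ℕ.sum (List.map-++ F (filter P? (f x)) _) ⟩
  ℕ.sum (map F (filter P? (f x)) List.++ map F (filter P? (concatMap f xs)))
    ≡⟨ ℕ.sum-++ (map F (filter P? (f x))) _ ⟩
  ℕ.sum (map F (filter P? (f x))) ℕ.+ ℕ.sum (map F (filter P? (concatMap f xs)))
    ≡⟨ cong (ℕ._+_ (ℕ.sum (map F (filter P? (f x))))) (sum-filter-concatMap P? F f xs) ⟩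
  ℕ.sum (map F (filter P? (f x))) ℕ.+ ℕ.sum (map (λ x → ℕ.sum (map F (filter P? (f x)))) xs) ∎
  where open ≡-Reasoning

sum-upTo : ∀ (G : ℕ → ℕ) {k n} → k ≤ n → (∀ i → k ≤ i → G i ≡ 0) → ℕ.sum (map G (upTo k)) ≡ sum {n} (G ∘ toℕ)
sum-upTo G {n = n} z≤n G≡0 = sym (trans (sum-cong-≗ {n} (λ i → G≡0 (toℕ i) z≤n)) (sum-replicate-zero n))
sum-upTo G {suc k} {suc n} (s≤s k≤n) G≡0 = cong (ℕ._+_ (G 0)) (begin
  ℕ.sum (map G (applyUpTo suc k))     ≡⟨ cong ℕ.sum (trans (List.map-applyUpTo suc G k) (sym (List.map-upTo (G ∘ suc) k))) ⟩
  ℕ.sum (map (G ∘ suc) (upTo k))      ≡⟨ sum-upTo (G ∘ suc) k≤n (λ i → G≡0 (suc i) ∘ s≤s) ⟩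
  sum {n} (G ∘ suc ∘ toℕ)             ∎)
  where open ≡-Reasoning

sum-Des : ∀ {n} π (F : ℕ × ℕ → ℕ) → length π ≤ n →
          ℕ.sum (map F (Des π)) ≡
          sum {n} (λ i → ℕ.sum (map (λ j → F (toℕ i , j))
            (filter (λ j → entry π (suc (toℕ i)) j <? entry π (toℕ i) j) (upTo (length (row π (toℕ i)))))))
sum-Des {n} π F len = begin
  ℕ.sum (map F (Des π))
    ≡⟨ sum-filter-concatMap P? F (λ i → map (i ,_) (upTo (length (row π i)))) (upTo (length π)) ⟩
  ℕ.sum (map (λ i → ℕ.sum (map F (filter P? (map (i ,_) (upTo (length (row π i))))))) (upTo (length π)))
    ≡⟨ cong ℕ.sum (List.map-cong (λ i → cong ℕ.sum (trans (cong (map F) (filter-map P? (i ,_) (upTo (length (row π i)))))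
         (sym (List.map-∘ (filter (λ j → P? (i , j)) (upTo (length (row π i)))))))) (upTo (length π))) ⟩
  ℕ.sum (map G (upTo (length π)))
    ≡⟨ sum-upTo G len beyond ⟩
  sum {n} (G ∘ toℕ) ∎
  where
  open ≡-Reasoning
  P? : ∀ ij → Dec (entry π (suc (proj₁ ij)) (proj₂ ij) < entry π (proj₁ ij) (proj₂ ij))
  P? (i , j) = entry π (suc i) j <? entry π i j
  G : ℕ → ℕ
  G i = ℕ.sum (map (λ j → F (i , j)) (filter (λ j → P? (i , j)) (upTo (length (row π i)))))
  beyond : ∀ i → length π ≤ i → G i ≡ 0
  beyond i len≤i = cong (λ l → ℕ.sum (map (λ j → F (i , j)) (filter (λ j → P? (i , j)) (upTo (length l))))) (row-≥ π len≤i)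

sum-const-+ : {A : Set} (U : ℕ) (V : A → ℕ) (xs : List A) →
              ℕ.sum (map (λ x → U ℕ.+ V x) xs) ≡ length xs ℕ.* U ℕ.+ ℕ.sum (map V xs)
sum-const-+ U V []       = refl
sum-const-+ U V (x ∷ xs) = trans (cong (ℕ._+_ (U ℕ.+ V x)) (sum-const-+ U V xs)) (interchange U (V x) (length xs ℕ.* U) _)
  where open import Algebra.Properties.CommutativeSemigroup ℕ.+-commutativeSemigroup

-- One coordinate of the exponent of a weight: `U` and `V` are the exponents, at that coordinate, of
-- the monomials put in place of the row and letter variables.
sum-Des-letters : ∀ {n m π} → PP n m π → (U : Fin n → ℕ) (V : Fin m → ℕ) →
  ℕ.sum (map (λ (i , j) → extend U i ℕ.+ extend V (pred (entry π i j))) (Des π)) ≡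
  sum (λ i → d π (toℕ i) ℕ.* U i) ℕ.+ sum (λ v → c π (suc (toℕ v)) ℕ.* V v)
sum-Des-letters {n} {m} {π} (pp , len , ≤m) U V = begin
  ℕ.sum (map (λ (i , j) → extend U i ℕ.+ extend V (pred (entry π i j))) (Des π))
    ≡⟨ sum-Des π _ len ⟩
  sum {n} (λ i → ℕ.sum (map (λ j → extend U (toℕ i) ℕ.+ extend V (pred (entry π (toℕ i) j))) (js i)))
    ≡⟨ sum-cong-≗ per-row ⟩
  sum {n} (λ i → d π (toℕ i) ℕ.* U i ℕ.+ sum (λ v → D i v ℕ.* V v))
    ≡⟨ ∑-distrib-+ (λ i → d π (toℕ i) ℕ.* U i) (λ i → sum (λ v → D i v ℕ.* V v)) ⟩
  sum (λ i → d π (toℕ i) ℕ.* U i) ℕ.+ sum {n} (λ i → sum (λ v → D i v ℕ.* V v))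
    ≡⟨ cong (ℕ._+_ (sum (λ i → d π (toℕ i) ℕ.* U i))) (begin
      -- Summing by rows first and by letters afterwards meets in the matrix `D`, whose column sums
      -- are `c` by `c-descents`.
      sum {n} (λ i → sum (λ v → D i v ℕ.* V v))   ≡⟨ ∑-comm (λ i v → D i v ℕ.* V v) ⟩
      sum (λ v → sum {n} (λ i → D i v ℕ.* V v))   ≡⟨ sum-cong-≗ (λ v → trans (sym (*-distribʳ-sum (V v) (λ i → D i v)))
                                                       (cong (ℕ._* V v) (sym (c-descents pp len (toℕ v))))) ⟩
      sum (λ v → c π (suc (toℕ v)) ℕ.* V v)       ∎) ⟩
  sum (λ i → d π (toℕ i) ℕ.* U i) ℕ.+ sum (λ v → c π (suc (toℕ v)) ℕ.* V v) ∎
  where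
  open ≡-Reasoning
  js : Fin n → List ℕ
  js i = filter (λ j → entry π (suc (toℕ i)) j <? entry π (toℕ i) j) (upTo (length (row π (toℕ i))))
  D : Fin n → Fin m → ℕ
  D i v = count (suc (toℕ v)) (rowDescents π (toℕ i))
  per-row : ∀ i → ℕ.sum (map (λ j → extend U (toℕ i) ℕ.+ extend V (pred (entry π (toℕ i) j))) (js i)) ≡
                  d π (toℕ i) ℕ.* U i ℕ.+ sum (λ v → D i v ℕ.* V v)
  per-row i = begin
    ℕ.sum (map (λ j → extend U (toℕ i) ℕ.+ extend V (pred (entry π (toℕ i) j))) (js i))
      ≡⟨ sum-const-+ (extend U (toℕ i)) _ (js i) ⟩
    d π (toℕ i) ℕ.* extend U (toℕ i) ℕ.+ ℕ.sum (map (λ j → extend V (pred (entry π (toℕ i) j))) (js i))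
      ≡⟨ cong₂ ℕ._+_ (cong (ℕ._*_ (d π (toℕ i))) (extend-toℕ U i)) (cong ℕ.sum (List.map-∘ (js i))) ⟩
    d π (toℕ i) ℕ.* U i ℕ.+ ℕ.sum (map (extend V ∘ pred) (rowDescents π (toℕ i)))
      ≡⟨ cong (ℕ._+_ (d π (toℕ i) ℕ.* U i)) (sum-letters V (descents-All (entry π (suc (toℕ i))) (row-positive pp (toℕ i)))
           (descents-All (entry π (suc (toℕ i))) (All-‼ (row π (toℕ i)) (≤m (toℕ i))))) ⟩
    d π (toℕ i) ℕ.* U i ℕ.+ sum (λ v → D i v ℕ.* V v) ∎

d-fromMatrix : ∀ {n m} (D : Vec (Vec ℕ m) n) i → d (fromMatrix D) (toℕ i) ≡ sum (lookup (lookup D i))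
d-fromMatrix D i = trans (d-descents (fromMatrix D) (toℕ i))
  (trans (cong length (rowDescents-fromMatrix D i)) (length-toWord (lookup D i)))

c-fromMatrix : ∀ {n m} (D : Vec (Vec ℕ m) n) v → c (fromMatrix D) (suc (toℕ v)) ≡ sum (λ i → lookup (lookup D i) v)
c-fromMatrix D v = let (pp , len , _) = fromMatrix-PP D in trans (c-descents pp len (toℕ v))
  (sum-cong-≗ (λ i → trans (cong (count (suc (toℕ v))) (rowDescents-fromMatrix D i)) (count-toWord (lookup D i) v)))

-- Both sides count the descents.
sum-d≡sum-c : ∀ {n m π} → PP n m π → sum {n} (λ i → d π (toℕ i)) ≡ sum {m} (λ v → c π (suc (toℕ v)))
sum-d≡sum-c {n} {m} π∈ with D , refl ← fromMatrix-surjective π∈ = begin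
  sum {n} (λ i → d (fromMatrix D) (toℕ i))       ≡⟨ sum-cong-≗ (d-fromMatrix D) ⟩
  sum (λ i → sum (lookup (lookup D i)))       ≡⟨ ∑-comm (λ i v → lookup (lookup D i) v) ⟩
  sum (λ v → sum (λ i → lookup (lookup D i) v))  ≡⟨ sum-cong-≗ (c-fromMatrix D) ⟨
  sum {m} (λ v → c (fromMatrix D) (suc (toℕ v))) ∎
  where open ≡-Reasoning

-- The polynomials g

weight-mon : ∀ {n m k π} {x : Fin n → Series k} {z : Fin m → Series k} (u : Fin n → Fin k → ℕ) (v : Fin m → Fin k → ℕ) →
             (∀ i → x i ≈ mon (u i)) → (∀ j → z j ≈ mon (v j)) → PP n m π →
             weight x z π ≈ mon (λ t → sum (λ i → d π (toℕ i) ℕ.* u i t) ℕ.+ sum (λ j → c π (suc (toℕ j)) ℕ.* v j t))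
weight-mon {π = π} u v x≈ z≈ π∈ e = trans
  (∏ˡ-mon (Des π) (λ { {i , j} _ → *-mon (at-mon {u = u} x≈ i) (at-mon {u = v} z≈ (pred (entry π i j))) }) e)
  (mon-cong (λ t → sum-Des-letters π∈ (λ i → u i t) (λ j → v j t)) e)

∏-^-mon : ∀ {n k} {x : Fin n → Series k} (u : Fin n → Fin k → ℕ) (r : Fin n → ℕ) → (∀ i → x i ≈ mon (u i)) →
          (∏ λ i → x i ^ r i) ≈ mon (λ t → sum (λ i → r i ℕ.* u i t))
∏-^-mon {n} u r x≈ = ∏-mon n (λ i → ^-mon {f = u i} (x≈ i) (r i))

weight-∏ : ∀ {n m k π} {x : Fin n → Series k} {z : Fin m → Series k} (u : Fin n → Fin k → ℕ) (v : Fin m → Fin k → ℕ) →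
           (∀ i → x i ≈ mon (u i)) → (∀ j → z j ≈ mon (v j)) → PP n m π →
           weight x z π ≈ (∏ λ i → x i ^ d π (toℕ i)) * (∏ λ j → z j ^ c π (suc (toℕ j)))
weight-∏ {π = π} u v x≈ z≈ π∈ e = trans (weight-mon u v x≈ z≈ π∈ e)
  (sym (*-mon (∏-^-mon u (d π ∘ toℕ) x≈) (∏-^-mon v (c π ∘ suc ∘ toℕ) z≈) e))

∏-cong : ∀ {k} n {F G : Fin n → Series k} → (∀ i → F i ≈ G i) → ∏ F ≈ ∏ G
∏-cong zero    F≈G = λ _ → refl
∏-cong (suc n) F≈G = *-cong (F≈G zero) (∏-cong n (F≈G ∘ suc))

^-cong-≡ : ∀ {k} (F : Series k) {r s} → r ≡ s → F ^ r ≈ F ^ s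
^-cong-≡ F refl _ = refl

-- Exponent vectors in the two groups of variables

sum-δ-injective : ∀ {n k} (ι : Fin n → Fin k) → (∀ {i j} → ι i ≡ ι j → i ≡ j) →
                  ∀ (α : Fin n → ℕ) y → sum (λ i → α i ℕ.* δ (ι i) (ι y)) ≡ α y
sum-δ-injective ι ι-inj α y = trans (sum-cong-≗ (λ i → term i (i Fin.≟ y))) (sum-δ y α)
  where
  term : ∀ i → Dec (i ≡ y) → α i ℕ.* δ (ι i) (ι y) ≡ δ y i ℕ.* α i
  term i (yes refl) = trans (cong (ℕ._*_ (α i)) (trans (δ-same (ι i)) (sym (δ-same i)))) (ℕ.*-comm (α i) (δ i i))
  term i (no  i≢y)  = trans (cong (ℕ._*_ (α i)) (trans (δ-other (i≢y ∘ sym ∘ ι-inj)) (sym (δ-other i≢y))))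
                            (ℕ.*-comm (α i) (δ y i))

sum-δ-outside : ∀ {n k} (ι : Fin n → Fin k) {t} → (∀ i → t ≢ ι i) → ∀ (α : Fin n → ℕ) → sum (λ i → α i ℕ.* δ (ι i) t) ≡ 0
sum-δ-outside {n} ι t∉ α = trans
  (sum-cong-≗ (λ i → trans (cong (ℕ._*_ (α i)) (δ-other (t∉ i))) (ℕ.*-zeroʳ (α i)))) (sum-replicate-zero n)

↑ˡ≢↑ʳ : ∀ {n m} (i : Fin n) (j : Fin m) → i ↑ˡ m ≢ n ↑ʳ j
↑ˡ≢↑ʳ {n} {m} i j eq with () ← trans (sym (Fin.splitAt-↑ˡ n i m)) (trans (cong (Fin.splitAt n) eq) (Fin.splitAt-↑ʳ n m j))

-- The exponents of the monomial x^α z^β.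
exponent : ∀ {n m} → (Fin n → ℕ) → (Fin m → ℕ) → Fin (n ℕ.+ m) → ℕ
exponent {n} {m} α β t = sum (λ i → α i ℕ.* δ (i ↑ˡ m) t) ℕ.+ sum (λ j → β j ℕ.* δ (n ↑ʳ j) t)

exponent-↑ˡ : ∀ {n m} (α : Fin n → ℕ) (β : Fin m → ℕ) i → exponent α β (i ↑ˡ m) ≡ α i
exponent-↑ˡ {n} {m} α β i = trans
  (cong₂ ℕ._+_ (sum-δ-injective (_↑ˡ m) (Fin.↑ˡ-injective m _ _) α i) (sum-δ-outside (n ↑ʳ_) (↑ˡ≢↑ʳ i) β))
  (ℕ.+-identityʳ (α i))

exponent-↑ʳ : ∀ {n m} (α : Fin n → ℕ) (β : Fin m → ℕ) j → exponent α β (n ↑ʳ j) ≡ β j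
exponent-↑ʳ {n} {m} α β j =
  cong₂ ℕ._+_ (sum-δ-outside (_↑ˡ m) (λ i → ↑ˡ≢↑ʳ i j ∘ sym) α) (sum-δ-injective (n ↑ʳ_) (Fin.↑ʳ-injective n _ _) β j)

tabulate-exponent : ∀ {n m} (α : Fin n → ℕ) (β : Fin m → ℕ) → tabulate (exponent α β) ≡ tabulate α ++ tabulate β
tabulate-exponent {n} {m} α β = lookup-extensional λ t →
  subst (λ t → lookup (tabulate (exponent α β)) t ≡ lookup (tabulate α ++ tabulate β) t)
    (Fin.join-splitAt n m t) (by-side (Fin.splitAt n t))
  where
  by-side : ∀ s → lookup (tabulate (exponent α β)) (Fin.join n m s) ≡ lookup (tabulate α ++ tabulate β) (Fin.join n m s)
  by-side (inj₁ i) = trans (Vec.lookup∘tabulate (exponent α β) (i ↑ˡ m)) (trans (exponent-↑ˡ α β i)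
    (sym (trans (Vec.lookup-++ˡ (tabulate α) (tabulate β) i) (Vec.lookup∘tabulate α i))))
  by-side (inj₂ j) = trans (Vec.lookup∘tabulate (exponent α β) (n ↑ʳ j)) (trans (exponent-↑ʳ α β j)
    (sym (trans (Vec.lookup-++ʳ (tabulate α) (tabulate β) j) (Vec.lookup∘tabulate β j))))

degree-tabulate : ∀ {k} (f : Fin k → ℕ) → degree (tabulate f) ≡ sum f
degree-tabulate {zero}  f = refl
degree-tabulate {suc k} f = cong (ℕ._+_ (f zero)) (degree-tabulate (f ∘ suc))

rowVar : ∀ n m → Fin n → Series (n ℕ.+ m)
rowVar n m i = var (i ↑ˡ m)

letterVar : ∀ n m → Fin m → Series (n ℕ.+ m)
letterVar n m j = var (n ↑ʳ j)

dExponents : ∀ n → Array → Fin n → ℕ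
dExponents n π i = d π (toℕ i)

cExponents : ∀ m → Array → Fin m → ℕ
cExponents m π j = c π (suc (toℕ j))

module _ {n m : ℕ} where

  private
    x = rowVar n m
    z = letterVar n m

  weight-exponent : ∀ {π} → PP n m π → weight x z π ≈ mon (exponent (dExponents n π) (cExponents m π))
  weight-exponent = weight-mon (λ i → δ (i ↑ˡ m)) (λ j → δ (n ↑ʳ j)) (λ i → var-mon (i ↑ˡ m)) (λ j → var-mon (n ↑ʳ j))

  weight-occurs : ∀ {π} e → PP n m π → OccursIn e (weight x z π) →
                  tabulate (dExponents n π) ++ tabulate (cExponents m π) ≡ e
  weight-occurs {π} e π∈ ≢0 = trans (sym (tabulate-exponent (dExponents n π) (cExponents m π)))
    (monomial-occurs {e′ = e} (≢0 ∘ trans (weight-exponent π∈ e)))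

  g-occurs : ∀ {p e} → OccursIn e (g p x z) →
             ∃[ π ] (PP n m π × π HasShape p) × OccursIn e (weight x z π)
  g-occurs {p} {e} ≢0 =
    let (π , π∈ , w≢0) = ∑ℤ-nonzero (elements E) (≢0 ∘ trans (∑-coefficient E (weight x z) e))
    in  π , Enumeration.sound E π∈ , w≢0
    where E = PP-ofShape n m p

  homogeneous : ∀ p (α : Vec ℕ n) (β : Vec ℕ m) → OccursIn (α ++ β) (g p x z) → degree α ≡ degree β
  homogeneous p α β occ with g-occurs {p} occ
  ... | π , (π∈ , _) , w≢0 with Vec.++-injective (tabulate (dExponents n π)) α (weight-occurs (α ++ β) π∈ w≢0)
  ... | refl , refl = trans (degree-tabulate (dExponents n π))
        (trans (sum-d≡sum-c π∈) (sym (degree-tabulate (cExponents m π))))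

  -- The part of top degree

  degree-weight : ∀ {π} e → PP n m π → OccursIn e (weight x z π) →
                  degree e ≡ sum (dExponents n π) ℕ.+ sum (dExponents n π)
  degree-weight {π} e π∈ w≢0 = begin
    degree e                                          ≡⟨ cong degree (weight-occurs e π∈ w≢0) ⟨
    degree (tabulate (dExponents n π) ++ tabulate (cExponents m π)) ≡⟨ Vec.sum-++ (tabulate (dExponents n π)) ⟩
    degree (tabulate (dExponents n π)) ℕ.+ degree (tabulate (cExponents m π))
      ≡⟨ cong₂ ℕ._+_ (degree-tabulate (dExponents n π)) (degree-tabulate (cExponents m π)) ⟩
    sum (dExponents n π) ℕ.+ sum (cExponents m π)     ≡⟨ cong (ℕ._+_ (sum (dExponents n π))) (sum-d≡sum-c π∈) ⟨
    sum (dExponents n π) ℕ.+ sum (dExponents n π)     ∎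
    where open ≡-Reasoning

  top⇒strict : ∀ p {π} e → PP n m π → π HasShape p → OccursIn e (weight x z π) →
               ∣ p ∣ₚ ℕ.+ ∣ p ∣ₚ ≤ degree e → ColumnStrict π
  top⇒strict p {π} e π∈@(_ , len , _) sh w≢0 large = full⇒strict π full
    where
    size≡ : ∣ p ∣ₚ ≡ sum {n} (λ i → length (row π (toℕ i)))
    size≡ = trans (cong ℕ.sum (sym sh)) (size-rows π len)
    halve : ∀ {s t} → s ℕ.+ s ≤ t ℕ.+ t → s ≤ t
    halve s≤t = ℕ.≮⇒≥ λ t<s → ℕ.<⇒≱ (ℕ.+-mono-< t<s t<s) s≤t
    full : ∀ i → d π i ≡ length (row π i)
    full i with i <? n
    ... | yes i<n = subst (λ i → d π i ≡ length (row π i)) (Fin.toℕ-fromℕ< i<n)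
      (sum-tight (λ i → d≤length π (toℕ i))
        (subst (_≤ sum (dExponents n π)) size≡ (halve (subst (∣ p ∣ₚ ℕ.+ ∣ p ∣ₚ ≤_) (degree-weight e π∈ w≢0) large)))
        (fromℕ< i<n))
    -- `ColumnStrict` quantifies over all row indices; the rows from index `n` on are empty.
    ... | no  i≮n = ℕ.≤-antisym (d≤length π i)
      (subst (λ r → length r ≤ d π i) (sym (row-≥ π (ℕ.≤-trans len (ℕ.≮⇒≥ i≮n)))) z≤n)

  -- When every cell is a descent, the descent word of a row is the row itself: its length is a part
  -- of `p`, and counting its letters over all rows gives `a` in place of `c`.
  weight-strict : ∀ {p π} → PP n m π → π HasShape p → ColumnStrict π →
                  weight x z π ≈ (∏ λ i → x i ^ part p (toℕ i)) * (∏ λ j → z j ^ a π (suc (toℕ j)))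
  weight-strict {p} {π} π∈@(pp , len , _) sh strict e = trans
    (weight-∏ (λ i → δ (i ↑ˡ m)) (λ j → δ (n ↑ʳ j)) (λ i → var-mon (i ↑ˡ m)) (λ j → var-mon (n ↑ʳ j)) π∈ e)
    (*-cong (∏-cong n (λ i → ^-cong-≡ (x i) (d≡ i))) (∏-cong m (λ j → ^-cong-≡ (z j) (c≡ j))) e)
    where
    d≡ : ∀ i → d π (toℕ i) ≡ part p (toℕ i)
    d≡ i = trans (d-descents π (toℕ i)) (trans (cong length (rowDescents-strict π strict (toℕ i)))
      (trans (sym (‼-map-length π (toℕ i))) (cong (_‼ toℕ i) sh)))
    c≡ : ∀ j → c π (suc (toℕ j)) ≡ a π (suc (toℕ j))
    c≡ j = trans (c-descents pp len (toℕ j)) (trans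
      (sum-cong-≗ {n} (λ i → cong (count (suc (toℕ j))) (rowDescents-strict π strict (toℕ i))))
      (sym (a-rows π len (suc (toℕ j)))))

  length-shape : ∀ {p π} → π HasShape p → length π ≡ ℓ p
  length-shape {π = π} sh = trans (sym (List.length-map length π)) (cong length sh)

  -- Covers every degree from twice the size of `p` upwards, not only that degree, so the difference
  -- from the leading product lives in lower degrees without further argument.
  top-degree : ∀ p → ℓ p ≤ n → ∀ e → ∣ p ∣ₚ ℕ.+ ∣ p ∣ₚ ≤ degree e →
               g p x z e ≡ ((∏ λ i → x i ^ part p (toℕ i)) * schur p z) e
  top-degree p ℓ≤n e large = begin
    ∑ (PP-ofShape n m p) (weight x z) e
      ≡⟨ ∑-support (PP-ofShape n m p) (columnStrictPlanePartitions m p) (weight x z) e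
           (λ (π∈@(pp , _ , ≤m) , sh) w≢0 → pp , top⇒strict p e π∈ sh w≢0 large , ≤m , sh)
           (λ (pp , _ , ≤m , sh) _ → (pp , len sh , ≤m) , sh) ⟩
    ∑ (columnStrictPlanePartitions m p) (weight x z) e
      ≡⟨ ∑-cong (columnStrictPlanePartitions m p)
           (λ (pp , strict , ≤m , sh) → weight-strict {p} (pp , len sh , ≤m) sh strict) e ⟩
    ∑ (columnStrictPlanePartitions m p) (λ π → (∏ λ i → x i ^ part p (toℕ i)) * (∏ λ j → z j ^ a π (suc (toℕ j)))) e
      ≡⟨ ∑-*-distribˡ (columnStrictPlanePartitions m p) (∏ λ i → x i ^ part p (toℕ i)) (λ π → ∏ λ j → z j ^ a π (suc (toℕ j))) e ⟨
    ((∏ λ i → x i ^ part p (toℕ i)) * schur p z) e ∎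
    where
    open ≡-Reasoning
    -- The enumeration behind `schur` has no bound on the number of rows; it is supplied by the
    -- shape.
    len : ∀ {π} → π HasShape p → length π ≤ n
    len sh = subst (_≤ n) (sym (length-shape {p} sh)) ℓ≤n

  leading-term : ∀ p → ℓ p ≤ n → Σ[ h ∈ Series (n ℕ.+ m) ]
                 g p x z ≈ (∏ λ i → x i ^ part p (toℕ i)) * schur p z + h
                 × (∀ e → OccursIn e h → degree e < ∣ p ∣ₚ ℕ.+ ∣ p ∣ₚ)
  leading-term p ℓ≤n =
      (λ e → g p x z e ℤ.- lead e)
    , (λ e → sym (begin
        lead e ℤ.+ (g p x z e ℤ.- lead e)     ≡⟨ ℤ.+-comm (lead e) _ ⟩
        (g p x z e ℤ.- lead e) ℤ.+ lead e     ≡⟨ ℤ.+-assoc (g p x z e) (ℤ.- lead e) (lead e) ⟩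
        g p x z e ℤ.+ (ℤ.- lead e ℤ.+ lead e) ≡⟨ cong (ℤ._+_ (g p x z e)) (ℤ.+-inverseˡ (lead e)) ⟩
        g p x z e ℤ.+ 0ℤ                      ≡⟨ ℤ.+-identityʳ _ ⟩
        g p x z e                             ∎))
    , (λ e ≢0 → ℕ.≰⇒> (λ large → ≢0 (ℤ.i≡j⇒i-j≡0 (top-degree p ℓ≤n e large))))
    where
    open ≡-Reasoning
    lead : Series (n ℕ.+ m)
    lead = (∏ λ i → x i ^ part p (toℕ i)) * schur p z

  -- The Cauchy product as a sum over matrices

  matrixExponent : Vec (Vec ℕ m) n → Fin (n ℕ.+ m) → ℕ
  matrixExponent D t = sum (λ i → sum (λ j → lookup (lookup D i) j ℕ.* (δ (i ↑ˡ m) t ℕ.+ δ (n ↑ʳ j) t)))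

  -- The product side keeps `x i * z j` together in each factor. Distributing and exchanging the
  -- sums separates the two groups, with row sums `d` and column sums `c` as exponents.
  matrixExponent-fromMatrix : ∀ D t → matrixExponent D t ≡
                              exponent (dExponents n (fromMatrix D)) (cExponents m (fromMatrix D)) t
  matrixExponent-fromMatrix D t = begin
    sum (λ i → sum (λ j → D[ i , j ] ℕ.* (δ (i ↑ˡ m) t ℕ.+ δ (n ↑ʳ j) t)))
      ≡⟨ sum-cong-≗ (λ i → trans (sum-cong-≗ (λ j → ℕ.*-distribˡ-+ D[ i , j ] (δ (i ↑ˡ m) t) (δ (n ↑ʳ j) t)))
           (∑-distrib-+ (λ j → D[ i , j ] ℕ.* δ (i ↑ˡ m) t) (λ j → D[ i , j ] ℕ.* δ (n ↑ʳ j) t))) ⟩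
    sum (λ i → sum (λ j → D[ i , j ] ℕ.* δ (i ↑ˡ m) t) ℕ.+ sum (λ j → D[ i , j ] ℕ.* δ (n ↑ʳ j) t))
      ≡⟨ ∑-distrib-+ (λ i → sum (λ j → D[ i , j ] ℕ.* δ (i ↑ˡ m) t)) (λ i → sum (λ j → D[ i , j ] ℕ.* δ (n ↑ʳ j) t)) ⟩
    sum (λ i → sum (λ j → D[ i , j ] ℕ.* δ (i ↑ˡ m) t)) ℕ.+ sum (λ i → sum (λ j → D[ i , j ] ℕ.* δ (n ↑ʳ j) t))
      ≡⟨ cong₂ ℕ._+_
           (sum-cong-≗ (λ i → trans (sym (*-distribʳ-sum (δ (i ↑ˡ m) t) (λ j → D[ i , j ])))
             (cong (λ r → r ℕ.* δ (i ↑ˡ m) t) (sym (d-fromMatrix D i)))))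
           (trans (∑-comm (λ i j → D[ i , j ] ℕ.* δ (n ↑ʳ j) t))
             (sum-cong-≗ (λ j → trans (sym (*-distribʳ-sum (δ (n ↑ʳ j) t) (λ i → D[ i , j ])))
               (cong (λ r → r ℕ.* δ (n ↑ʳ j) t) (sym (c-fromMatrix D j)))))) ⟩
    exponent (dExponents n (fromMatrix D)) (cExponents m (fromMatrix D)) t ∎
    where
    open ≡-Reasoning
    D[_,_] : Fin n → Fin m → ℕ
    D[ i , j ] = lookup (lookup D i) j

  box : ℕ → List (Vec (Vec ℕ m) n)
  box N = vectors (vectors (upTo N) m) n

  box-unique : ∀ N → Unique (box N)
  box-unique N = vectors-unique (vectors-unique (Unique.upTo⁺ N) m) n

  cauchy-product : SumsOver box matrixExponent (∏ λ i → ∏ λ j → 1/[1- x i * z j ])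
  cauchy-product = ∏-sumsOver {box = λ N → vectors (upTo N) m} n
    {λ i ks t → sum (λ j → lookup ks j ℕ.* (δ (i ↑ˡ m) t ℕ.+ δ (n ↑ʳ j) t))}
    λ i → ∏-sumsOver {box = upTo} m {λ j r t → r ℕ.* (δ (i ↑ˡ m) t ℕ.+ δ (n ↑ʳ j) t)}
    -- The coordinate of `x i` witnesses that `x i * z j` has no constant term: its exponent there
    -- is at least 1.
    λ j → geometric-sumsOver (*-mon (var-mon (i ↑ˡ m)) (var-mon (n ↑ʳ j))) (i ↑ˡ m)
      (λ ≡0 → ℕ.1+n≢0 (trans (cong (λ t → t ℕ.+ δ (n ↑ʳ j) (i ↑ˡ m)) (sym (δ-same (i ↑ˡ m)))) ≡0))

  weight-fromMatrix : ∀ D → weight x z (fromMatrix D) ≈ mon (matrixExponent D)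
  weight-fromMatrix D e = trans (weight-exponent (fromMatrix-PP D) e)
    (mon-cong (λ t → sym (matrixExponent-fromMatrix D t)) e)

  -- Each D i j is at most the exponent of x i.
  ∈-box : ∀ D e → OccursIn e (weight x z (fromMatrix D)) → D ∈ box (suc (degree e))
  ∈-box D e w≢0 = vectors-complete D λ i → vectors-complete (lookup D i) λ j → ∈-upTo⁺ (s≤s (begin
    lookup (lookup D i) j                              ≤⟨ term≤sum (lookup (lookup D i)) j ⟩
    sum (lookup (lookup D i))                          ≡⟨ d-fromMatrix D i ⟨
    d (fromMatrix D) (toℕ i)                           ≡⟨ exponent-↑ˡ α β i ⟨
    exponent α β (i ↑ˡ m)                              ≡⟨ Vec.lookup∘tabulate (exponent α β) (i ↑ˡ m) ⟨
    lookup (tabulate (exponent α β)) (i ↑ˡ m)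
      ≡⟨ cong (λ e → lookup e (i ↑ˡ m)) (trans (tabulate-exponent α β) (weight-occurs e (fromMatrix-PP D) w≢0)) ⟩
    lookup e (i ↑ˡ m)                                  ≤⟨ lookup≤degree e (i ↑ˡ m) ⟩
    degree e                                           ∎))
    where
    open ℕ.≤-Reasoning
    α = dExponents n (fromMatrix D)
    β = cExponents m (fromMatrix D)
    term≤sum : ∀ {k} (f : Fin k → ℕ) j → f j ≤ sum f
    term≤sum {suc k} f zero    = ℕ.m≤m+n (f zero) _
    term≤sum {suc k} f (suc j) = ℕ.≤-trans (term≤sum (f ∘ suc) j) (ℕ.m≤n+m _ (f zero))

-- The Cauchy identity

Partition-≡ : ∀ {p q} → parts p ≡ parts q → p ≡ q
Partition-≡ {partition _ _ _} {partition _ _ _} refl = refl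

shape-decreasing : ∀ {π} → IsPlanePartition π → Linked _≥_ (shape π)
shape-decreasing {[]}        _  = []
shape-decreasing {_ ∷ []}    _  = [-]
shape-decreasing {_ ∷ _ ∷ _} pp = length-row₀≤ pp ∷ shape-decreasing (IsPlanePartition-tail pp)

BoundedPartition : ℕ → Set
BoundedPartition n = Σ[ p ∈ Partition ] ℓ p ≤ n

BoundedPartition-≡ : ∀ {n} {p q : BoundedPartition n} → parts (proj₁ p) ≡ parts (proj₁ q) → p ≡ q
BoundedPartition-≡ {p = p , _} {q , _} eq with refl ← Partition-≡ {p} {q} eq = cong (p ,_) (ℕ.≤-irrelevant _ _)

_≟ₚ_ : ∀ {n} → DecidableEquality (BoundedPartition n)
p ≟ₚ q = map′ BoundedPartition-≡ (cong (parts ∘ proj₁)) (List.≡-dec ℕ._≟_ (parts (proj₁ p)) (parts (proj₁ q)))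

partitionOf : ∀ {n m π} → PP n m π → BoundedPartition n
partitionOf {n} {π = π} (pp , len , _) =
    partition (shape π) (All.map⁺ (IsPlanePartition.rows-nonempty pp)) (shape-decreasing pp)
  , subst (_≤ n) (sym (List.length-map length π)) len

cauchy : ∀ n m → HasSum {I = BoundedPartition n} (λ (p , _) → g p (rowVar n m) (letterVar n m))
                   (∏ λ i → ∏ λ j → 1/[1- rowVar n m i * letterVar n m j ])
cauchy n m e = L , L-unique , complete , (begin
  (∏ λ i → ∏ λ j → 1/[1- x i * z j ]) e
    ≡⟨ cauchy-product {n} {m} (suc (degree e)) e ℕ.≤-refl ⟩
  ∑ℤ matrices (λ D → mon (matrixExponent D) e)
    ≡⟨ ∑ℤ-cong matrices (λ {D} _ → weight-fromMatrix {n} {m} D e) ⟨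
  ∑ℤ matrices (λ D → weight x z (fromMatrix D) e)
    ≡⟨ ∑ℤ-map fromMatrix (λ π → weight x z π e) matrices ⟨
  ∑ℤ (map fromMatrix matrices) (λ π → weight x z π e)
    -- The shapes in `L` can carry further arrays, from matrices outside the box; by `∈-box` their
    -- weights miss `e`.
    ≡⟨ ∑ℤ-support (λ π → weight x z π e) (Unique.map⁺ fromMatrix-injective (box-unique {n} {m} (suc (degree e)))) arrays-unique
         (λ π∈ _ → matrix⇒array π∈) array⇒matrix ⟩
  ∑ℤ (concatMap arraysOf L) (λ π → weight x z π e)
    ≡⟨ ∑ℤ-concatMap arraysOf (λ π → weight x z π e) L ⟩
  ∑ℤ L (λ p → ∑ℤ (arraysOf p) (λ π → weight x z π e))
    ≡⟨ ∑ℤ-cong L (λ {p} _ → ∑-coefficient (PP-ofShape n m (proj₁ p)) (weight x z) e) ⟨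
  ∑ℤ L (λ (p , _) → g p x z e) ∎)
  where
  open ≡-Reasoning
  x = rowVar n m
  z = letterVar n m
  matrices : List (Vec (Vec ℕ m) n)
  -- Entries up to and including `degree e`, the range that `∈-box` requires.
  matrices = box (suc (degree e))
  shapeOf : Vec (Vec ℕ m) n → BoundedPartition n
  shapeOf D = partitionOf (fromMatrix-PP D)
  L : List (BoundedPartition n)
  -- Distinct matrices may share a shape, whereas `HasSum` lists each partition once. These shapes
  -- suffice, because any occurrence of `e` comes from a matrix in the box.
  L = deduplicate _≟ₚ_ (map shapeOf matrices)
  L-unique : Unique L
  L-unique = DecUnique.deduplicate-! _≟ₚ_ (map shapeOf matrices)
  arraysOf : BoundedPartition n → List Array
  arraysOf (p , _) = elements (PP-ofShape n m p)
  shapeOf∈L : ∀ {D} → D ∈ matrices → shapeOf D ∈ L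
  shapeOf∈L D∈ = ∈-deduplicate⁺ _≟ₚ_ (∈-map⁺ shapeOf D∈)
  arrays-unique : Unique (concatMap arraysOf L)
  arrays-unique = Unique.concat⁺
    (All.map⁺ (All.tabulate (λ {p} _ → Enumeration.unique (PP-ofShape n m (proj₁ p)))))
    (AllPairs.map⁺ (AllPairs.map disjoint L-unique))
    where
    disjoint : ∀ {p q} → p ≢ q → Disjoint (arraysOf p) (arraysOf q)
    disjoint {p} {q} p≢q (π∈p , π∈q) = p≢q (BoundedPartition-≡ (trans
      (sym (proj₂ (Enumeration.sound (PP-ofShape n m (proj₁ p)) π∈p)))
      (proj₂ (Enumeration.sound (PP-ofShape n m (proj₁ q)) π∈q))))
  matrix⇒array : ∀ {π} → π ∈ map fromMatrix matrices → π ∈ concatMap arraysOf L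
  matrix⇒array π∈ with D , D∈ , refl ← ∈-map⁻ fromMatrix π∈ = ∈-concatMap⁺ arraysOf
    (lose (shapeOf∈L D∈) (Enumeration.complete (PP-ofShape n m (proj₁ (shapeOf D))) (fromMatrix-PP D , refl)))
  array⇒matrix : ∀ {π} → π ∈ concatMap arraysOf L → OccursIn e (weight x z π) → π ∈ map fromMatrix matrices
  array⇒matrix π∈ w≢0 with p , _ , π∈p ← find (∈-concatMap⁻ arraysOf {xs = L} π∈)
    with D , refl ← fromMatrix-surjective (proj₁ (Enumeration.sound (PP-ofShape n m (proj₁ p)) π∈p))
    = ∈-map⁺ fromMatrix (∈-box D e w≢0)
  complete : ∀ p → OccursIn e (g (proj₁ p) x z) → p ∈ L
  complete (p , ℓ≤n) occ with π , (π∈ , sh) , w≢0 ← g-occurs {p = p} occ with D , refl ← fromMatrix-surjective π∈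
    = subst (_∈ L) (BoundedPartition-≡ sh) (shapeOf∈L (∈-box D e w≢0))

-- Specialisation of the row variables to 1

specialisation : ∀ n m p → ℓ p ≤ n → g p (λ (_ : Fin n) → 1# {m}) var ≈ dualGrothendieck p var
specialisation n m p ℓ≤n e = begin
  ∑ (PP-ofShape n m p) (weight {n} (λ _ → 1#) var) e
    -- The value 1 is the monomial with all exponents 0, so the row factors of the weight contribute
    -- nothing.
    ≡⟨ ∑-cong (PP-ofShape n m p) (λ {π} (π∈ , _) e → trans (weight-mon (λ _ _ → 0) δ (λ _ → 1-mon) var-mon π∈ e)
         (trans (mon-cong (λ t → cong (λ s → s ℕ.+ sum (λ j → c π (suc (toℕ j)) ℕ.* δ j t)) (no-x π)) e)
           (sym (∏-^-mon δ (cExponents m π) var-mon e)))) e ⟩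
  ∑ (PP-ofShape n m p) (λ π → ∏ λ j → var j ^ c π (suc (toℕ j))) e
    -- Every array of shape `p` has `ℓ p` rows, so `ℓ p ≤ n` makes the row bound in `PP` automatic.
    ≡⟨ ∑-support (PP-ofShape n m p) (planePartitions m p) (λ π → ∏ λ j → var j ^ c π (suc (toℕ j))) e
         (λ ((pp , _ , ≤m) , sh) _ → pp , ≤m , sh)
         (λ (pp , ≤m , sh) _ → (pp , subst (_≤ n) (sym (length-shape {n} {m} {p} sh)) ℓ≤n , ≤m) , sh) ⟩
  dualGrothendieck p var e ∎
  where
  open ≡-Reasoning
  no-x : ∀ π → sum {n} (λ i → d π (toℕ i) ℕ.* 0) ≡ 0
  no-x π = trans (sum-cong-≗ {n} (λ i → ℕ.*-zeroʳ (d π (toℕ i)))) (sum-replicate-zero n)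

theorem5p2 : ∀ (n m : ℕ) → 1 ≤ n → 1 ≤ m →
    let x : Fin n → Series (n ℕ.+ m)
        x i = var (i ↑ˡ m)
        z : Fin m → Series (n ℕ.+ m)
        z j = var (n ↑ʳ j)
    in
    -- (i)
    (∀ (p : Partition) →
      (ℓ p ≤ n →
        Σ[ h ∈ Series (n ℕ.+ m) ]
          g p x z ≈ (∏ λ i → x i ^ part p (toℕ i)) * schur p z + h
          × (∀ e → OccursIn e h → degree e < ∣ p ∣ₚ ℕ.+ ∣ p ∣ₚ))
      × (∀ (α : Vec ℕ n) (β : Vec ℕ m) → OccursIn (α ++ β) (g p x z) → degree α ≡ degree β))
    -- (ii)
    × (∀ (p : Partition) →
        g p x z ≈ ∑ (PP-ofShape n m p) (λ π →
          (∏ λ i → x i ^ d π (toℕ i)) * (∏ λ j → z j ^ c π (suc (toℕ j)))))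
    -- (iii)
    × (∀ (p : Partition) → ℓ p ≤ n →
        g p (λ (_ : Fin n) → 1# {m}) var ≈ dualGrothendieck p var)
    -- (iv)
    × HasSum {I = Σ[ p ∈ Partition ] ℓ p ≤ n} (λ (p , _) → g p x z)
        (∏ λ i → ∏ λ j → 1/[1- x i * z j ])
theorem5p2 n m _ _ =
    (λ p → leading-term {n} {m} p , homogeneous {n} {m} p)
  , (λ p → ∑-cong (PP-ofShape n m p)
      (λ (π∈ , _) → weight-∏ (λ i → δ (i ↑ˡ m)) (λ j → δ (n ↑ʳ j)) (λ i → var-mon (i ↑ˡ m)) (λ j → var-mon (n ↑ʳ j)) π∈))
  , specialisation n m
  , cauchy n m
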